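{- For every integer $n\geq 1$, $$\frac{(1+y)^{n}}{t}A_{n}(t^{2})+\sum_{k=0}^{n}\binom{n}{k}(1+y)^{k}(1-t^{2})^{n-k}A_{k}(t^{2})$$ $$=(1+yt)(1+t)(1+yt^{2})^{n-1}\,P_{n}^{(\mathrm{lpk},\mathrm{val},\mathrm{des})}\left(\frac{t(1+y)(y+t)}{(y+t^{2})(1+yt)},\frac{t(1+y)(1+yt)}{(1+yt^{2})(y+t)},\frac{y+t^{2}}{1+yt^{2}}\right).$$
   Context: $\mathfrak{S}_n$ is the set of permutations $\pi=\pi_1\cdots\pi_n$ of $[n]=\{1,\dots,n\}$. For $\pi\in\mathfrak{S}_n$: $\mathrm{des}(\pi)$ is the number of $i\in[n-1]$ with $\pi_i>\pi_{i+1}$; $\mathrm{lpk}(\pi)$ is the number of left peaks, where $i\in[n-1]$ is a left peak if either $2\le i\le n-1$ and $\pi_{i-1}<\pi_i>\pi_{i+1}$, or $i=1$ and $\pi_1>\pi_2$; $\mathrm{val}(\pi)$ is the number of valleys, i.e. of $i$ with $2\le i\le n-1$ and $\pi_{i-1}>\pi_i<\pi_{i+1}$. $A_n(t)=\sum_{\pi\in\mathfrak{S}_n}t^{\mathrm{des}(\pi)+1}$ for $n\ge1$ and $A_0(t)=1$. For $n\ge1$, $P_n^{(\mathrm{lpk},\mathrm{val},\mathrm{des})}(y,z,t)=\sum_{\pi\in\mathfrak{S}_n}y^{\mathrm{lpk}(\pi)}z^{\mathrm{val}(\pi)}t^{\mathrm{des}(\pi)}$. The identity is one of rational functions in the indeterminates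 $y,t$. -}

module Defs where

open import Algebra.Bundles using (CommutativeRing)
open import Data.Bool.Base using (Bool; _∧_; if_then_else_)
open import Data.Empty using (⊥-elim)
import Data.Integer.Properties as ℤ
open import Data.List.Base
  using (List; []; _∷_; map; foldr; filter; upTo; cartesianProductWith)
open import Data.List.Relation.Unary.Unique.DecPropositional using (unique?)
open import Data.Nat.Base as ℕ using (ℕ; zero; suc)
import Data.Nat.Properties as ℕ
open import Data.Product.Base using (_,_)
open import Data.Sum.Base using (_⊎_; inj₁; inj₂; [_,_]′)
open import Level using (Level; 0ℓ; _⊔_) renaming (suc to lsuc)
open import Relation.Binary.Definitions using (Decidable)
open import Relation.Nullary using (¬_; yes; no)
open import Relation.Nullary.Decidable
  using (False; toWitnessFalse; map′; _×-dec_; toSum)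

private variable
  c ℓ : Level

record IntegralDomain c ℓ : Set (lsuc (c ⊔ ℓ)) where
  field
    commutativeRing : CommutativeRing c ℓ
  open CommutativeRing commutativeRing public
  infix 4 _≟_
  field
    _≟_           : Decidable _≈_
    1≉0           : ¬ 1# ≈ 0#
    noZeroDivisor : ∀ x y → x * y ≈ 0# → x ≈ 0# ⊎ y ≈ 0#

ℤ-domain : IntegralDomain 0ℓ 0ℓ
ℤ-domain = record
  { commutativeRing = ℤ.+-*-commutativeRing
  ; _≟_             = ℤ._≟_
  ; 1≉0             = λ ()
  ; noZeroDivisor   = λ x y → ℤ.i*j≡0⇒i≡0∨j≡0 x
  }

module Polynomial (D : IntegralDomain c ℓ) where
  private
    module D = IntegralDomain D
    open import Algebra.Properties.Ring D.ring using (-0#≈0#)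

  -- a₀ ∷ a₁ ∷ … stands for a₀ + a₁X + …; trailing zeros are allowed, so
  -- the equality is equality of all coefficients.
  Poly : Set c
  Poly = List D.Carrier

  coeff : Poly → ℕ → D.Carrier
  coeff []      _       = D.0#
  coeff (a ∷ p) zero    = a
  coeff (a ∷ p) (suc i) = coeff p i

  infix 4 _≋_
  record _≋_ (p q : Poly) : Set ℓ where
    constructor coeffs
    field at : ∀ i → coeff p i D.≈ coeff q i
  open _≋_

  infixl 6 _⊕_
  infixl 7 _⊛_ _·_

  _⊕_ : Poly → Poly → Poly
  []      ⊕ q       = q
  (a ∷ p) ⊕ []      = a ∷ p
  (a ∷ p) ⊕ (b ∷ q) = (a D.+ b) ∷ (p ⊕ q)

  _·_ : D.Carrier → Poly → Poly
  a · p = map (a D.*_) p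

  ⊖_ : Poly → Poly
  ⊖_ = map (λ a → D.- a)

  _⊛_ : Poly → Poly → Poly
  []      ⊛ q = []
  (a ∷ p) ⊛ q = (a · q) ⊕ (D.0# ∷ (p ⊛ q))

  const : D.Carrier → Poly
  const a = a ∷ []

  X : Poly
  X = D.0# ∷ D.1# ∷ []

  private
    coeff-⊕ : ∀ p q i → coeff (p ⊕ q) i D.≈ coeff p i D.+ coeff q i
    coeff-⊕ []      q       i       = D.sym (D.+-identityˡ _)
    coeff-⊕ (a ∷ p) []      i       = D.sym (D.+-identityʳ _)
    coeff-⊕ (a ∷ p) (b ∷ q) zero    = D.refl
    coeff-⊕ (a ∷ p) (b ∷ q) (suc i) = coeff-⊕ p q i

    coeff-· : ∀ a p i → coeff (a · p) i D.≈ a D.* coeff p i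
    coeff-· a []      i       = D.sym (D.zeroʳ a)
    coeff-· a (b ∷ p) zero    = D.refl
    coeff-· a (b ∷ p) (suc i) = coeff-· a p i

    coeff-⊖ : ∀ p i → coeff (⊖ p) i D.≈ D.- coeff p i
    coeff-⊖ []      i       = D.sym -0#≈0#
    coeff-⊖ (b ∷ p) zero    = D.refl
    coeff-⊖ (b ∷ p) (suc i) = coeff-⊖ p i

    refl : ∀ {p} → p ≋ p
    refl .at i = D.refl

    sym : ∀ {p q} → p ≋ q → q ≋ p
    sym e .at i = D.sym (e .at i)

    trans : ∀ {p q r} → p ≋ q → q ≋ r → p ≋ r
    trans e f .at i = D.trans (e .at i) (f .at i)

    infixr 5 _∷≋_
    _∷≋_ : ∀ {a b p q} → a D.≈ b → p ≋ q → (a ∷ p) ≋ (b ∷ q)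
    (e ∷≋ f) .at zero    = e
    (e ∷≋ f) .at (suc i) = f .at i

    0∷[] : ∀ {a} → a D.≈ D.0# → (a ∷ []) ≋ []
    0∷[] e .at zero    = e
    0∷[] e .at (suc i) = D.refl

    tail≋ : ∀ {a b p q} → (a ∷ p) ≋ (b ∷ q) → p ≋ q
    tail≋ e .at i = e .at (suc i)

    tail≋[] : ∀ {a p} → (a ∷ p) ≋ [] → p ≋ []
    tail≋[] e .at i = e .at (suc i)

    ∷≋[] : ∀ {a p} → a D.≈ D.0# → p ≋ [] → (a ∷ p) ≋ []
    ∷≋[] e f = trans (e ∷≋ f) (0∷[] D.refl)

    ⊕-cong : ∀ {p p′ q q′} → p ≋ p′ → q ≋ q′ → p ⊕ q ≋ p′ ⊕ q′
    ⊕-cong {p} {p′} {q} {q′} e f .at i =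
      D.trans (coeff-⊕ p q i)
        (D.trans (D.+-cong (e .at i) (f .at i)) (D.sym (coeff-⊕ p′ q′ i)))

    ⊕-assoc : ∀ p q r → (p ⊕ q) ⊕ r ≋ p ⊕ (q ⊕ r)
    ⊕-assoc p q r .at i =
      D.trans (coeff-⊕ (p ⊕ q) r i)
      (D.trans (D.+-congʳ (coeff-⊕ p q i))
      (D.trans (D.+-assoc _ _ _)
      (D.trans (D.+-congˡ (D.sym (coeff-⊕ q r i)))
      (D.sym (coeff-⊕ p (q ⊕ r) i)))))

    ⊕-comm : ∀ p q → p ⊕ q ≋ q ⊕ p
    ⊕-comm p q .at i =
      D.trans (coeff-⊕ p q i)
      (D.trans (D.+-comm _ _) (D.sym (coeff-⊕ q p i)))

    ⊕-identityʳ : ∀ p → p ⊕ [] ≋ p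
    ⊕-identityʳ p = ⊕-comm p []

    ⊖-cong : ∀ {p q} → p ≋ q → ⊖ p ≋ ⊖ q
    ⊖-cong {p} {q} e .at i =
      D.trans (coeff-⊖ p i)
      (D.trans (D.-‿cong (e .at i)) (D.sym (coeff-⊖ q i)))

    ⊖-inverseʳ : ∀ p → p ⊕ (⊖ p) ≋ []
    ⊖-inverseʳ p .at i =
      D.trans (coeff-⊕ p (⊖ p) i)
      (D.trans (D.+-congˡ (coeff-⊖ p i)) (D.-‿inverseʳ _))

    ⊖-inverseˡ : ∀ p → (⊖ p) ⊕ p ≋ []
    ⊖-inverseˡ p = trans (⊕-comm (⊖ p) p) (⊖-inverseʳ p)

    ·-cong : ∀ {a b p q} → a D.≈ b → p ≋ q → a · p ≋ b · q
    ·-cong {a} {b} {p} {q} e f .at i =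
      D.trans (coeff-· a p i)
      (D.trans (D.*-cong e (f .at i)) (D.sym (coeff-· b q i)))

    0·≋ : ∀ {a} p → a D.≈ D.0# → a · p ≋ []
    0·≋ {a} p e .at i =
      D.trans (coeff-· a p i) (D.trans (D.*-congʳ e) (D.zeroˡ _))

    ·-identity : ∀ p → D.1# · p ≋ p
    ·-identity p .at i = D.trans (coeff-· _ p i) (D.*-identityˡ _)

    ·-assoc : ∀ a b p → a · (b · p) ≋ (a D.* b) · p
    ·-assoc a b p .at i =
      D.trans (coeff-· a (b · p) i)
      (D.trans (D.*-congˡ (coeff-· b p i))
      (D.trans (D.sym (D.*-assoc _ _ _)) (D.sym (coeff-· _ p i))))

    ·-distribˡ : ∀ a p q → a · (p ⊕ q) ≋ a · p ⊕ a · q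
    ·-distribˡ a p q .at i =
      D.trans (coeff-· a (p ⊕ q) i)
      (D.trans (D.*-congˡ (coeff-⊕ p q i))
      (D.trans (D.distribˡ _ _ _)
      (D.trans (D.sym (D.+-cong (coeff-· a p i) (coeff-· a q i)))
      (D.sym (coeff-⊕ (a · p) (a · q) i)))))

    ·-distribʳ : ∀ a b p → (a D.+ b) · p ≋ a · p ⊕ b · p
    ·-distribʳ a b p .at i =
      D.trans (coeff-· _ p i)
      (D.trans (D.distribʳ _ _ _)
      (D.trans (D.sym (D.+-cong (coeff-· a p i) (coeff-· b p i)))
      (D.sym (coeff-⊕ (a · p) (b · p) i))))

    interchange : ∀ p q r s → (p ⊕ q) ⊕ (r ⊕ s) ≋ (p ⊕ r) ⊕ (q ⊕ s)
    interchange p q r s =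
      trans (⊕-assoc p q _)
      (trans (⊕-cong (refl {p}) (trans (sym (⊕-assoc q r s))
        (trans (⊕-cong (⊕-comm q r) (refl {s})) (⊕-assoc r q s))))
      (sym (⊕-assoc p r _)))

    shift-⊕ : ∀ p q → D.0# ∷ (p ⊕ q) ≋ (D.0# ∷ p) ⊕ (D.0# ∷ q)
    shift-⊕ p q = D.sym (D.+-identityˡ _) ∷≋ refl

    ⊛-zeroˡ : ∀ {p} q → p ≋ [] → p ⊛ q ≋ []
    ⊛-zeroˡ {[]}    q e = refl
    ⊛-zeroˡ {a ∷ p} q e =
      ⊕-cong (0·≋ q (e .at 0)) (∷≋[] D.refl (⊛-zeroˡ q (tail≋[] e)))

    ⊛-zeroʳ : ∀ p → p ⊛ [] ≋ []
    ⊛-zeroʳ []      = refl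
    ⊛-zeroʳ (a ∷ p) = ∷≋[] D.refl (⊛-zeroʳ p)

    ⊛-congˡ : ∀ p {q q′} → q ≋ q′ → p ⊛ q ≋ p ⊛ q′
    ⊛-congˡ []      e = refl
    ⊛-congˡ (a ∷ p) e = ⊕-cong (·-cong D.refl e) (D.refl ∷≋ ⊛-congˡ p e)

    ⊛-congʳ : ∀ {p p′} q → p ≋ p′ → p ⊛ q ≋ p′ ⊛ q
    ⊛-congʳ {[]}    {p′}     q e = sym (⊛-zeroˡ q (sym e))
    ⊛-congʳ {a ∷ p} {[]}     q e = ⊛-zeroˡ q e
    ⊛-congʳ {a ∷ p} {b ∷ p′} q e =
      ⊕-cong (·-cong (e .at 0) refl) (D.refl ∷≋ ⊛-congʳ q (tail≋ e))

    ⊛-∷ʳ : ∀ p b q → p ⊛ (b ∷ q) ≋ b · p ⊕ (D.0# ∷ (p ⊛ q))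
    ⊛-∷ʳ []      b q = sym (0∷[] D.refl)
    ⊛-∷ʳ (a ∷ p) b q = D.+-congʳ (D.*-comm a b) ∷≋
      trans (⊕-cong (refl {a · q}) (⊛-∷ʳ p b q))
      (trans (sym (⊕-assoc (a · q) _ _))
      (trans (⊕-cong (⊕-comm (a · q) (b · p)) refl)
      (⊕-assoc (b · p) _ _)))

    ⊛-comm : ∀ p q → p ⊛ q ≋ q ⊛ p
    ⊛-comm []      q = sym (⊛-zeroʳ q)
    ⊛-comm (a ∷ p) q =
      trans (⊕-cong refl (D.refl ∷≋ ⊛-comm p q)) (sym (⊛-∷ʳ q a p))

    ⊛-distribʳ : ∀ r p q → (p ⊕ q) ⊛ r ≋ p ⊛ r ⊕ q ⊛ r
    ⊛-distribʳ r []      q       = refl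
    ⊛-distribʳ r (a ∷ p) []      = sym (⊕-identityʳ _)
    ⊛-distribʳ r (a ∷ p) (b ∷ q) =
      trans (⊕-cong (·-distribʳ a b r)
        (trans (D.refl ∷≋ ⊛-distribʳ r p q) (shift-⊕ (p ⊛ r) (q ⊛ r))))
      (interchange (a · r) (b · r) _ _)

    ⊛-distribˡ : ∀ r p q → r ⊛ (p ⊕ q) ≋ r ⊛ p ⊕ r ⊛ q
    ⊛-distribˡ r p q =
      trans (⊛-comm r _)
      (trans (⊛-distribʳ r p q) (⊕-cong (⊛-comm p r) (⊛-comm q r)))

    ·-⊛ : ∀ a p q → (a · p) ⊛ q ≋ a · (p ⊛ q)
    ·-⊛ a []      q = refl
    ·-⊛ a (b ∷ p) q =
      trans (⊕-cong (sym (·-assoc a b q))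
                    (D.sym (D.zeroʳ a) ∷≋ ·-⊛ a p q))
      (sym (·-distribˡ a (b · q) _))

    shift-⊛ : ∀ p q → (D.0# ∷ p) ⊛ q ≋ D.0# ∷ (p ⊛ q)
    shift-⊛ p q = ⊕-cong (0·≋ q D.refl) refl

    ⊛-assoc : ∀ p q r → (p ⊛ q) ⊛ r ≋ p ⊛ (q ⊛ r)
    ⊛-assoc []      q r = refl
    ⊛-assoc (a ∷ p) q r =
      trans (⊛-distribʳ r (a · q) _)
      (⊕-cong (·-⊛ a q r)
        (trans (shift-⊛ (p ⊛ q) r) (D.refl ∷≋ ⊛-assoc p q r)))

    ⊛-identityˡ : ∀ p → const D.1# ⊛ p ≋ p
    ⊛-identityˡ p =
      trans (⊕-cong (·-identity p) (0∷[] D.refl)) (⊕-identityʳ p)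

  commutativeRing : CommutativeRing c ℓ
  commutativeRing = record
    { Carrier = Poly
    ; _≈_ = _≋_
    ; _+_ = _⊕_
    ; _*_ = _⊛_
    ; -_  = ⊖_
    ; 0#  = []
    ; 1#  = const D.1#
    ; isCommutativeRing = record
      { isRing = record
        { +-isAbelianGroup = record
          { isGroup = record
            { isMonoid = record
              { isSemigroup = record
                { isMagma = record
                  { isEquivalence = record
                    { refl = refl ; sym = sym ; trans = trans }
                  ; ∙-cong = ⊕-cong
                  }
                ; assoc = ⊕-assoc
                }
              ; identity = (λ _ → refl) , ⊕-identityʳ
              }
            ; inverse = ⊖-inverseˡ , ⊖-inverseʳ
            ; ⁻¹-cong = ⊖-cong
            }
          ; comm = ⊕-comm
          }
        ; *-cong = λ {p} {p′} {q} {q′} e f → trans (⊛-congʳ q e) (⊛-congˡ p′ f)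
        ; *-assoc = ⊛-assoc
        ; *-identity = ⊛-identityˡ , λ p → trans (⊛-comm p _) (⊛-identityˡ p)
        ; distrib = ⊛-distribˡ , ⊛-distribʳ
        }
      ; *-comm = ⊛-comm
      }
    }

  private
    dec : Decidable _≋_
    dec []      []      = yes refl
    dec []      (b ∷ q) = map′ (λ (e , f) → sym (∷≋[] (D.sym e) (sym f)))
                               (λ e → e .at 0 , sym (tail≋[] (sym e)))
                               ((D.0# D.≟ b) ×-dec dec [] q)
    dec (a ∷ p) []      = map′ (λ (e , f) → ∷≋[] e f)
                               (λ e → e .at 0 , tail≋[] e)
                               ((a D.≟ D.0#) ×-dec dec p [])
    dec (a ∷ p) (b ∷ q) = map′ (λ (e , f) → e ∷≋ f)
                               (λ e → e .at 0 , tail≋ e)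
                               ((a D.≟ b) ×-dec dec p q)

    -- Divide X out of whichever factor has zero constant term.
    noZeroDivisor : ∀ p q → p ⊛ q ≋ [] → p ≋ [] ⊎ q ≋ []
    noZeroDivisor []      q       e = inj₁ refl
    noZeroDivisor (a ∷ p) []      e = inj₂ refl
    noZeroDivisor (a ∷ p) (b ∷ q) e =
      [ (λ a≈0 →
          [ (λ f → inj₁ (∷≋[] a≈0 f)) , inj₂ ]′
          (noZeroDivisor p (b ∷ q) (tail≋[] (trans (sym
            (⊕-cong (0·≋ (b ∷ q) a≈0) refl)) e))))
      , (λ a≉0 →
          let b≈0 = [ (λ a≈0 → ⊥-elim (a≉0 a≈0)) , (λ b≈0 → b≈0) ]′
                    (D.noZeroDivisor a b
                      (D.trans (D.sym (D.+-identityʳ _)) (e .at 0)))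
          in
          [ inj₁ , (λ f → inj₂ (∷≋[] b≈0 f)) ]′
          (noZeroDivisor (a ∷ p) q (tail≋[] (trans (sym (trans
            (⊛-∷ʳ (a ∷ p) b q) (⊕-cong (0·≋ (a ∷ p) b≈0) refl))) e))))
      ]′ (toSum (a D.≟ D.0#))

  domain : IntegralDomain c ℓ
  domain = record
    { commutativeRing = commutativeRing
    ; _≟_             = dec
    ; 1≉0             = λ e → D.1≉0 (e .at 0)
    ; noZeroDivisor   = noZeroDivisor
    }

module Fractions (D : IntegralDomain c ℓ) where
  private
    module D = IntegralDomain D
    open import Relation.Binary.Reasoning.Setoid D.setoid
    open import Algebra.Properties.Group D.+-group
      using () renaming (x∙y⁻¹≈ε⇒x≈y to x-y≈0⇒x≈y)
    open import Algebra.Properties.Ring D.ring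
      using (-‿distribˡ-*; [y-z]x≈yx-zx)
    open import Algebra.Solver.Ring.NaturalCoefficients.Default
      D.commutativeSemiring
    open D using (_+_; _*_; -_; _≈_; 0#; 1#)

  record Fraction : Set (c ⊔ ℓ) where
    constructor frac
    field
      num   : D.Carrier
      den   : D.Carrier
      den≉0 : ¬ den ≈ 0#
  open Fraction

  infix 4 _≃_
  record _≃_ (x y : Fraction) : Set ℓ where
    constructor cross
    field cross≈ : num x * den y ≈ num y * den x
  open _≃_

  private
    *≉0 : ∀ {a b} → ¬ a ≈ 0# → ¬ b ≈ 0# → ¬ a * b ≈ 0#
    *≉0 a≉0 b≉0 e = [ a≉0 , b≉0 ]′ (D.noZeroDivisor _ _ e)

  infixl 6 _⊕_
  infixl 7 _⊛_

  _⊕_ : Fraction → Fraction → Fraction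
  frac a b b≉0 ⊕ frac c d d≉0 = frac (a * d + c * b) (b * d) (*≉0 b≉0 d≉0)

  _⊛_ : Fraction → Fraction → Fraction
  frac a b b≉0 ⊛ frac c d d≉0 = frac (a * c) (b * d) (*≉0 b≉0 d≉0)

  ⊖_ : Fraction → Fraction
  ⊖ frac a b b≉0 = frac (- a) b b≉0

  embed : D.Carrier → Fraction
  embed a = frac a 1# D.1≉0

  private
    cancelʳ : ∀ a b d → ¬ d ≈ 0# → a * d ≈ b * d → a ≈ b
    cancelʳ a b d d≉0 e =
      [ x-y≈0⇒x≈y a b , (λ d≈0 → ⊥-elim (d≉0 d≈0)) ]′
      (D.noZeroDivisor (a + - b) d (begin
        (a + - b) * d        ≈⟨ [y-z]x≈yx-zx d a b ⟩
        a * d + - (b * d)    ≈⟨ D.+-congʳ e ⟩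
        b * d + - (b * d)    ≈⟨ D.-‿inverseʳ _ ⟩
        0#                   ∎))

    refl : ∀ {x} → x ≃ x
    refl = cross D.refl

    sym : ∀ {x y} → x ≃ y → y ≃ x
    sym (cross e) = cross (D.sym e)

    trans : ∀ {x y z} → x ≃ y → y ≃ z → x ≃ z
    trans {frac a b _} {frac c d d≉0} {frac e f _} (cross p) (cross q) =
      cross (cancelʳ _ _ d d≉0 (begin
        a * f * d    ≈⟨ swap a f d ⟩
        a * d * f    ≈⟨ D.*-congʳ p ⟩
        c * b * f    ≈⟨ swap c b f ⟩
        c * f * b    ≈⟨ D.*-congʳ q ⟩
        e * d * b    ≈⟨ swap e d b ⟩
        e * b * d    ∎))
      where
      swap : ∀ x y z →
        x * y * z ≈ x * z * y
      swap = solve 3 (λ x y z →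
        x :* y :* z :=
        x :* z :* y) D.refl

    ⊕-cong : ∀ {x x′ y y′} → x ≃ x′ → y ≃ y′ → x ⊕ y ≃ x′ ⊕ y′
    ⊕-cong {frac a b _} {frac a′ b′ _} {frac c d _} {frac c′ d′ _}
           (cross p) (cross q) = cross (begin
      (a * d + c * b) * (b′ * d′)                ≈⟨ expand a b c d b′ d′ ⟩
      (a * b′) * (d * d′) + (c * d′) * (b * b′)  ≈⟨ D.+-cong (D.*-congʳ p) (D.*-congʳ q) ⟩
      (a′ * b) * (d * d′) + (c′ * d) * (b * b′)  ≈⟨ collect a′ b′ c′ d′ b d ⟩
      (a′ * d′ + c′ * b′) * (b * d)              ∎)
      where
      expand : ∀ a b c d b′ d′ →
        (a * d + c * b) * (b′ * d′) ≈ (a * b′) * (d * d′) + (c * d′) * (b * b′)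
      expand = solve 6 (λ a b c d b′ d′ →
        (a :* d :+ c :* b) :* (b′ :* d′) :=
        (a :* b′) :* (d :* d′) :+ (c :* d′) :* (b :* b′)) D.refl
      collect : ∀ a b c d b′ d′ →
        (a * b′) * (d′ * d) + (c * d′) * (b′ * b) ≈ (a * d + c * b) * (b′ * d′)
      collect = solve 6 (λ a b c d b′ d′ →
        (a :* b′) :* (d′ :* d) :+ (c :* d′) :* (b′ :* b) :=
        (a :* d :+ c :* b) :* (b′ :* d′)) D.refl

    ⊛-cong : ∀ {x x′ y y′} → x ≃ x′ → y ≃ y′ → x ⊛ y ≃ x′ ⊛ y′
    ⊛-cong {frac a b _} {frac a′ b′ _} {frac c d _} {frac c′ d′ _}
           (cross p) (cross q) = cross (begin
      (a * c) * (b′ * d′)  ≈⟨ medial a c b′ d′ ⟩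
      (a * b′) * (c * d′)  ≈⟨ D.*-cong p q ⟩
      (a′ * b) * (c′ * d)  ≈⟨ medial a′ b c′ d ⟩
      (a′ * c′) * (b * d)  ∎)
      where
      medial : ∀ x y z w →
        (x * y) * (z * w) ≈ (x * z) * (y * w)
      medial = solve 4 (λ x y z w →
        (x :* y) :* (z :* w) :=
        (x :* z) :* (y :* w)) D.refl

    ⊖-cong : ∀ {x y} → x ≃ y → ⊖ x ≃ ⊖ y
    ⊖-cong {frac a b _} {frac c d _} (cross p) = cross (begin
      - a * d    ≈⟨ D.sym (-‿distribˡ-* a d) ⟩
      - (a * d)  ≈⟨ D.-‿cong p ⟩
      - (c * b)  ≈⟨ -‿distribˡ-* c b ⟩
      - c * b    ∎)

    ⊕-assoc : ∀ x y z → (x ⊕ y) ⊕ z ≃ x ⊕ (y ⊕ z)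
    ⊕-assoc (frac a b _) (frac c d _) (frac e f _) = cross (lemma a b c d e f)
      where
      lemma : ∀ a b c d e f →
        ((a * d + c * b) * f + e * (b * d)) * (b * (d * f)) ≈
        (a * (d * f) + (c * f + e * d) * b) * (b * d * f)
      lemma = solve 6 (λ a b c d e f →
        ((a :* d :+ c :* b) :* f :+ e :* (b :* d)) :* (b :* (d :* f)) :=
        (a :* (d :* f) :+ (c :* f :+ e :* d) :* b) :* (b :* d :* f)) D.refl

    ⊕-comm : ∀ x y → x ⊕ y ≃ y ⊕ x
    ⊕-comm (frac a b _) (frac c d _) = cross (lemma a b c d)
      where
      lemma : ∀ a b c d →
        (a * d + c * b) * (d * b) ≈ (c * b + a * d) * (b * d)
      lemma = solve 4 (λ a b c d →
        (a :* d :+ c :* b) :* (d :* b) :=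
        (c :* b :+ a :* d) :* (b :* d)) D.refl

    ⊕-identityˡ : ∀ x → embed 0# ⊕ x ≃ x
    ⊕-identityˡ (frac a b _) = cross (lemma a b)
      where
      lemma : ∀ a b →
        (0# * b + a * 1#) * b ≈ a * (1# * b)
      lemma = solve 2 (λ a b →
        (con 0 :* b :+ a :* con 1) :* b :=
        a :* (con 1 :* b)) D.refl

    ⊖-inverseˡ : ∀ x → (⊖ x) ⊕ x ≃ embed 0#
    ⊖-inverseˡ (frac a b _) = cross (begin
      (- a * b + a * b) * 1#  ≈⟨ D.*-identityʳ _ ⟩
      - a * b + a * b         ≈⟨ D.sym (D.distribʳ b (- a) a) ⟩
      (- a + a) * b           ≈⟨ D.*-congʳ (D.-‿inverseˡ a) ⟩
      0# * b                  ≈⟨ D.zeroˡ b ⟩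
      0#                      ≈⟨ D.sym (D.zeroˡ _) ⟩
      0# * (b * b)            ∎)

    ⊛-assoc : ∀ x y z → (x ⊛ y) ⊛ z ≃ x ⊛ (y ⊛ z)
    ⊛-assoc (frac a b _) (frac c d _) (frac e f _) = cross (lemma a b c d e f)
      where
      lemma : ∀ a b c d e f →
        (a * c * e) * (b * (d * f)) ≈ (a * (c * e)) * (b * d * f)
      lemma = solve 6 (λ a b c d e f →
        (a :* c :* e) :* (b :* (d :* f)) :=
        (a :* (c :* e)) :* (b :* d :* f)) D.refl

    ⊛-comm : ∀ x y → x ⊛ y ≃ y ⊛ x
    ⊛-comm (frac a b _) (frac c d _) = cross (lemma a b c d)
      where
      lemma : ∀ a b c d →
        (a * c) * (d * b) ≈ (c * a) * (b * d)
      lemma = solve 4 (λ a b c d →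
        (a :* c) :* (d :* b) :=
        (c :* a) :* (b :* d)) D.refl

    ⊛-identityˡ : ∀ x → embed 1# ⊛ x ≃ x
    ⊛-identityˡ (frac a b _) = cross (lemma a b)
      where
      lemma : ∀ a b →
        (1# * a) * b ≈ a * (1# * b)
      lemma = solve 2 (λ a b →
        (con 1 :* a) :* b :=
        a :* (con 1 :* b)) D.refl

    ⊛-distribˡ : ∀ x y z → x ⊛ (y ⊕ z) ≃ x ⊛ y ⊕ x ⊛ z
    ⊛-distribˡ (frac a b _) (frac c d _) (frac e f _) =
      cross (lemma a b c d e f)
      where
      lemma : ∀ a b c d e f →
        (a * (c * f + e * d)) * (b * d * (b * f)) ≈
        (a * c * (b * f) + a * e * (b * d)) * (b * (d * f))
      lemma = solve 6 (λ a b c d e f →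
        (a :* (c :* f :+ e :* d)) :* (b :* d :* (b :* f)) :=
        (a :* c :* (b :* f) :+ a :* e :* (b :* d)) :* (b :* (d :* f))) D.refl

    ⊛-distribʳ : ∀ x y z → (y ⊕ z) ⊛ x ≃ y ⊛ x ⊕ z ⊛ x
    ⊛-distribʳ x y z =
      trans (⊛-comm (y ⊕ z) x)
      (trans (⊛-distribˡ x y z) (⊕-cong (⊛-comm x y) (⊛-comm x z)))

  commutativeRing : CommutativeRing (c ⊔ ℓ) ℓ
  commutativeRing = record
    { Carrier = Fraction
    ; _≈_ = _≃_
    ; _+_ = _⊕_
    ; _*_ = _⊛_
    ; -_  = ⊖_
    ; 0#  = embed 0#
    ; 1#  = embed 1#
    ; isCommutativeRing = record
      { isRing = record
        { +-isAbelianGroup = record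
          { isGroup = record
            { isMonoid = record
              { isSemigroup = record
                { isMagma = record
                  { isEquivalence = record
                    { refl = refl ; sym = sym ; trans = trans }
                  ; ∙-cong = ⊕-cong
                  }
                ; assoc = ⊕-assoc
                }
              ; identity = ⊕-identityˡ
                         , λ x → trans (⊕-comm x (embed 0#)) (⊕-identityˡ x)
              }
            ; inverse = ⊖-inverseˡ
                      , λ x → trans (⊕-comm x (⊖ x)) (⊖-inverseˡ x)
            ; ⁻¹-cong = ⊖-cong
            }
          ; comm = ⊕-comm
          }
        ; *-cong = ⊛-cong
        ; *-assoc = ⊛-assoc
        ; *-identity = ⊛-identityˡ
                     , λ x → trans (⊛-comm x (embed 1#)) (⊛-identityˡ x)
        ; distrib = ⊛-distribˡ , ⊛-distribʳ
        }
      ; *-comm = ⊛-comm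
      }
    }

  infix 4 _≃?_
  _≃?_ : Decidable _≃_
  x ≃? y = map′ cross cross≈ (num x * den y D.≟ num y * den x)

  -- The implicit side condition is found by evaluation when y is closed.
  infixl 7 _/_
  _/_ : (x y : Fraction) {y≄0 : False (y ≃? embed 0#)} → Fraction
  (x / frac c d d≉0) {y≄0} = x ⊛ frac d c c≉0
    where
    c≉0 : ¬ c ≈ 0#
    c≉0 c≈0 = toWitnessFalse y≄0 (cross (begin
      c * 1#  ≈⟨ D.*-congʳ c≈0 ⟩
      0# * 1# ≈⟨ D.zeroˡ _ ⟩
      0#      ≈⟨ D.sym (D.zeroˡ _) ⟩
      0# * d  ∎))

  /-cancel : ∀ x y {y≄0 : False (y ≃? embed 0#)} → (x / y) {y≄0} ⊛ y ≃ x
  /-cancel (frac a b _) (frac c d _) = cross (lemma a b c d)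
    where
    lemma : ∀ a b c d →
      (a * d * c) * b ≈ a * (b * c * d)
    lemma = solve 4 (λ a b c d →
      (a :* d :* c) :* b :=
      a :* (b :* c :* d)) D.refl

-- ℚ(y,t) as the field of fractions of ℤ[t][y]: t is the inner and y the outer
-- indeterminate.
module ℤ[t]    = Polynomial ℤ-domain
module ℤ[t][y] = Polynomial ℤ[t].domain
module ℚ⟨y,t⟩  = Fractions ℤ[t][y].domain

y t : ℚ⟨y,t⟩.Fraction
y = ℚ⟨y,t⟩.embed ℤ[t][y].X
t = ℚ⟨y,t⟩.embed (ℤ[t][y].const ℤ[t].X)

words : List ℕ → ℕ → List (List ℕ)
words letters zero    = [] ∷ []
words letters (suc k) = cartesianProductWith _∷_ letters (words letters k)

-- The permutations π₁⋯πₙ of [n] are the words of length n over {1,…,n} with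
-- pairwise distinct letters.
𝔖 : ℕ → List (List ℕ)
𝔖 n = filter (unique? ℕ._≟_) (words (map suc (upTo n)) n)

count : Bool → ℕ
count b = if b then 1 else 0

des : List ℕ → ℕ
des (a ∷ b ∷ w) = count (b ℕ.<ᵇ a) ℕ.+ des (b ∷ w)
des _           = 0

-- Only the peaks at positions 2 ≤ i ≤ n-1; lpk adds the possible one at i = 1.
pk : List ℕ → ℕ
pk (a ∷ b ∷ c ∷ w) = count ((a ℕ.<ᵇ b) ∧ (c ℕ.<ᵇ b)) ℕ.+ pk (b ∷ c ∷ w)
pk _               = 0

lpk : List ℕ → ℕ
lpk (a ∷ b ∷ w) = count (b ℕ.<ᵇ a) ℕ.+ pk (a ∷ b ∷ w)
lpk _           = 0

val : List ℕ → ℕ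
val (a ∷ b ∷ c ∷ w) = count ((b ℕ.<ᵇ a) ∧ (b ℕ.<ᵇ c)) ℕ.+ val (b ∷ c ∷ w)
val _               = 0

-- A n x and P n y z t are the values of A_n and P_n^(lpk,val,des) at elements of R.
module Enumerators (R : CommutativeRing c ℓ) where
  open CommutativeRing R
  open import Algebra.Properties.Semiring.Exp semiring using (_^_)

  ∑𝔖 : ℕ → (List ℕ → Carrier) → Carrier
  ∑𝔖 n f = foldr (λ π s → f π + s) 0# (𝔖 n)

  A : ℕ → Carrier → Carrier
  A zero    x = 1#
  A (suc n) x = ∑𝔖 (suc n) λ π → x ^ (des π ℕ.+ 1)

  P : ℕ → (y z t : Carrier) → Carrier
  P n y z t = ∑𝔖 n λ π → y ^ lpk π * z ^ val π * t ^ des π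

open CommutativeRing ℚ⟨y,t⟩.commutativeRing public
  using (_≈_; _+_; _*_; _-_; 1#; semiring)
open ℚ⟨y,t⟩ public using (_/_)
open Enumerators ℚ⟨y,t⟩.commutativeRing public using (A; P)
open import Algebra.Properties.Semiring.Exp semiring public using (_^_)
open import Algebra.Properties.Semiring.Mult semiring public using (_×_)
open import Algebra.Properties.Semiring.Sum semiring public using (sum⁺-syntax)

-- Building a permutation letter by letter, all that matters about the letters
-- still to come is how many of them, a and b, lie below and above the last
-- letter.  Let D(a,b) and U(a,b) be the total weights of the completions that
-- start with a descent and with an ascent.  Then D(a+1,b) - D(a,b+1) and
-- U(a,b+1) - U(a+1,b) are linear in D(a,b) and U(a,b).  With y, z, t replaced by
-- the arguments of P and each letter weighted by 1 + y t², the eigenvalues of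
-- this recurrence are y q and - q, where q = 1 - t².  Since U(a,0) = D(0,b) = 0,
-- the two eigenvectors give, in terms of exponential generating functions, a
-- functional equation for G = 1 + t + ∑ t RHSₙ xⁿ/n!, namely
--   G = q (1 + t e^(q x)) + t² e^((1+y) q x) G.
-- The same recurrence with the weight t² per descent gives
--   𝒜 = q + t² e^((1+y) q x) 𝒜,  where 𝒜 = ∑ (1+y)ⁿ Aₙ(t²) xⁿ/n!,
-- hence G = (1 + t e^(q x)) 𝒜.
module Submission where

open import Algebra.Bundles using (CommutativeRing; CommutativeSemiring)
open import Algebra.Structures.Biased using (isCommutativeSemiringˡ)
open import Data.Bool.Base using (Bool; true; false; not; _∧_; if_then_else_)
open import Data.Empty using (⊥-elim)
open import Data.Fin.Base using (Fin; toℕ; fromℕ; inject₁)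
open import Data.Fin.Properties using (toℕ<n; toℕ-fromℕ; toℕ-inject₁)
open import Data.List.Base
  using (List; []; _∷_; _++_; _ʳ++_; map; foldr; filter; length; upTo; cartesianProductWith)
open import Data.List.Properties
  using (filter-all; filter-reject; length-map; length-upTo)
open import Data.List.Relation.Unary.All as All using (All; []; _∷_)
import Data.List.Relation.Unary.All.Properties as All
open import Data.List.Relation.Unary.AllPairs using (AllPairs; []; _∷_)
import Data.List.Relation.Unary.AllPairs.Properties as AllPairs
open import Data.List.Relation.Unary.Unique.DecPropositional using (unique?)
open import Data.List.Relation.Unary.Unique.Propositional using (Unique)
open import Data.Nat.Base as ℕ using (ℕ; zero; suc; _∸_; _<_; _>_; _<ᵇ_; s≤s)
open import Data.Nat.Combinatorics using (_C_; nCk+nC[k+1]≡[n+1]C[k+1])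
open import Data.Nat.Combinatorics.Specification using (k>n⇒nCk≡0)
import Data.Nat.Properties as ℕ
open import Data.Product.Base using (_,_) renaming (_×_ to _∧′_)
open import Data.Unit.Base using (tt)
open import Function.Base using (_∘_)
open import Level using (_⊔_)
open import Relation.Binary.Definitions using (tri<; tri≈; tri>)
open import Relation.Binary.PropositionalEquality.Core as ≡ using (_≡_; _≢_)
open import Relation.Binary.PropositionalEquality.Properties using ()
  renaming (setoid to ≡-setoid)
open import Relation.Binary.Structures using (IsEquivalence)
open import Relation.Nullary using (does; ¬?)
open import Relation.Nullary.Decidable using (False)
import Relation.Unary as Unary

open import Defs using (𝔖; words; des; pk; lpk; val; count; module Enumerators)

-- Boolean comparison of natural numbers.

<⇒<ᵇ≡true : ∀ {m n} → m < n → (m <ᵇ n) ≡ true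
<⇒<ᵇ≡true {m} {n} m<n with m <ᵇ n | ℕ.<⇒<ᵇ m<n
... | true | _ = ≡.refl

>⇒<ᵇ≡false : ∀ {m n} → m > n → (m <ᵇ n) ≡ false
>⇒<ᵇ≡false {m} {n} m>n with m <ᵇ n | ℕ.<ᵇ⇒< m n
... | false | _   = ≡.refl
... | true  | m<n = ⊥-elim (ℕ.<-asym m>n (m<n tt))

-- Hurwitz series over a commutative ring.

-- Exponential generating functions ∑ fₙ xⁿ/n! are handled as sequences f, so
-- that the derivative is the shift and the product is given by Leibniz' rule.
module Hurwitz {c ℓ} (R : CommutativeRing c ℓ) where
  open CommutativeRing R
  open import Algebra.Properties.CommutativeSemiring.Exp commutativeSemiring
    using (_^_; ^-distrib-*)
  open import Algebra.Properties.Semiring.Mult semiring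
    using (_×_; ×-congˡ; ×-homo-+)
  open import Algebra.Properties.Semiring.Sum semiring
    using (sum⁺-syntax; sum-cong-≋; ∑-distrib-+; sum-init-last)
  open import Algebra.Properties.CommutativeSemigroup +-commutativeSemigroup
    using (interchange)
  open import Relation.Binary.Reasoning.Setoid setoid

  Series : Set c
  Series = ℕ → Carrier

  infix 4 _≋_
  -- A record, unlike the bare family of equalities, lets both series be inferred from the type of a
  -- proof.
  record _≋_ (f g : Series) : Set ℓ where
    constructor coeffs
    field at : ∀ n → f n ≈ g n
  open _≋_ public

  infixl 6 _⊕_
  infixl 7 _⊛_

  _⊕_ : Series → Series → Series
  (f ⊕ g) n = f n + g n

  deriv : Series → Series
  deriv f n = f (suc n)

  _⊛_ : Series → Series → Series
  (f ⊛ g) zero    = f 0 * g 0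
  (f ⊛ g) (suc n) = (deriv f ⊛ g) n + (f ⊛ deriv g) n

  const : Carrier → Series
  const a zero    = a
  const a (suc n) = 0#

  exp : Carrier → Series
  exp q n = q ^ n

  -- The substitution of `a` x for x.
  scale : Carrier → Series → Series
  scale a f n = a ^ n * f n

  ⊛-cong : ∀ {f f′ g g′} → (∀ n → f n ≈ f′ n) → (∀ n → g n ≈ g′ n) →
           ∀ n → (f ⊛ g) n ≈ (f′ ⊛ g′) n
  ⊛-cong p q zero    = *-cong (p 0) (q 0)
  ⊛-cong p q (suc n) =
    +-cong (⊛-cong (p ∘ suc) q n) (⊛-cong p (q ∘ suc) n)

  ⊛-comm : ∀ f g n → (f ⊛ g) n ≈ (g ⊛ f) n
  ⊛-comm f g zero    = *-comm _ _
  ⊛-comm f g (suc n) =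
    trans (+-cong (⊛-comm (deriv f) g n) (⊛-comm f (deriv g) n)) (+-comm _ _)

  ⊛-distribʳ : ∀ h f g n → ((f ⊕ g) ⊛ h) n ≈ (f ⊛ h) n + (g ⊛ h) n
  ⊛-distribʳ h f g zero    = distribʳ _ _ _
  ⊛-distribʳ h f g (suc n) =
    trans (+-cong (⊛-distribʳ h (deriv f) (deriv g) n) (⊛-distribʳ (deriv h) f g n))
          (interchange _ _ _ _)

  ⊛-distribˡ : ∀ h f g n → (h ⊛ (f ⊕ g)) n ≈ (h ⊛ f) n + (h ⊛ g) n
  ⊛-distribˡ h f g n = trans (⊛-comm h (f ⊕ g) n)
    (trans (⊛-distribʳ h f g n) (+-cong (⊛-comm f h n) (⊛-comm g h n)))

  ⊛-assoc : ∀ f g h n → ((f ⊛ g) ⊛ h) n ≈ (f ⊛ (g ⊛ h)) n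
  ⊛-assoc f g h zero    = *-assoc _ _ _
  ⊛-assoc f g h (suc n) = begin
    ((deriv f ⊛ g ⊕ f ⊛ deriv g) ⊛ h) n + ((f ⊛ g) ⊛ deriv h) n
      ≈⟨ +-cong (⊛-distribʳ h _ _ n) (⊛-assoc f g (deriv h) n) ⟩
    (((deriv f ⊛ g) ⊛ h) n + ((f ⊛ deriv g) ⊛ h) n) + (f ⊛ (g ⊛ deriv h)) n
      ≈⟨ +-congʳ (+-cong (⊛-assoc (deriv f) g h n) (⊛-assoc f (deriv g) h n)) ⟩
    ((deriv f ⊛ (g ⊛ h)) n + (f ⊛ (deriv g ⊛ h)) n) + (f ⊛ (g ⊛ deriv h)) n
      ≈⟨ +-assoc _ _ _ ⟩
    (deriv f ⊛ (g ⊛ h)) n + ((f ⊛ (deriv g ⊛ h)) n + (f ⊛ (g ⊛ deriv h)) n)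
      ≈⟨ +-congˡ (⊛-distribˡ f _ _ n) ⟨
    (deriv f ⊛ (g ⊛ h)) n + (f ⊛ (deriv g ⊛ h ⊕ g ⊛ deriv h)) n ∎

  ⊛-*ˡ : ∀ a f g n → ((λ m → a * f m) ⊛ g) n ≈ a * (f ⊛ g) n
  ⊛-*ˡ a f g zero    = *-assoc _ _ _
  ⊛-*ˡ a f g (suc n) =
    trans (+-cong (⊛-*ˡ a (deriv f) g n) (⊛-*ˡ a f (deriv g) n))
          (sym (distribˡ _ _ _))

  ⊛-*ʳ : ∀ a f g n → (f ⊛ (λ m → a * g m)) n ≈ a * (f ⊛ g) n
  ⊛-*ʳ a f g n =
    trans (⊛-comm f _ n) (trans (⊛-*ˡ a g f n) (*-congˡ (⊛-comm g f n)))

  ⊛-zeroˡ : ∀ f n → ((λ _ → 0#) ⊛ f) n ≈ 0#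
  ⊛-zeroˡ f zero    = zeroˡ _
  ⊛-zeroˡ f (suc n) =
    trans (+-cong (⊛-zeroˡ f n) (⊛-zeroˡ (deriv f) n)) (+-identityˡ _)

  const-⊛ : ∀ a f n → (const a ⊛ f) n ≈ a * f n
  const-⊛ a f zero    = refl
  const-⊛ a f (suc n) =
    trans (+-cong (⊛-zeroˡ f n) (const-⊛ a (deriv f) n)) (+-identityˡ _)

  const-*-homo : ∀ a b → const (a * b) ≋ const a ⊛ const b
  const-*-homo a b .at zero    = refl
  const-*-homo a b .at (suc n) =
    sym (trans (const-⊛ a (const b) (suc n)) (zeroʳ a))

  -- Both sides solve F′ = (p + q) F with F(0) = 1.
  exp-⊛ : ∀ p q → exp p ⊛ exp q ≋ exp (p + q)
  exp-⊛ p q .at zero    = *-identityˡ _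
  exp-⊛ p q .at (suc n) = begin
    ((λ m → p * exp p m) ⊛ exp q) n + (exp p ⊛ (λ m → q * exp q m)) n
      ≈⟨ +-cong (⊛-*ˡ p _ _ n) (⊛-*ʳ q _ _ n) ⟩
    p * (exp p ⊛ exp q) n + q * (exp p ⊛ exp q) n  ≈⟨ distribʳ _ p q ⟨
    (p + q) * (exp p ⊛ exp q) n                    ≈⟨ *-congˡ (exp-⊛ p q .at n) ⟩
    (p + q) * exp (p + q) n                        ∎

  exp-0 : exp 0# ≋ const 1#
  exp-0 .at zero    = refl
  exp-0 .at (suc n) = zeroˡ _

  -- By the chain rule `deriv-scale` each derivative releases one factor `a`; Leibniz' rule then
  -- carries the induction.
  scale-⊛ : ∀ a f g → scale a (f ⊛ g) ≋ scale a f ⊛ scale a g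
  scale-⊛ a f g .at n = go f g n
    where
    deriv-scale : ∀ f n → deriv (scale a f) n ≈ a * scale a (deriv f) n
    deriv-scale f n = *-assoc _ _ _

    go : ∀ f g n → scale a (f ⊛ g) n ≈ (scale a f ⊛ scale a g) n
    go f g zero    = begin
      1# * (f 0 * g 0)         ≈⟨ *-identityˡ _ ⟩
      f 0 * g 0                ≈⟨ *-cong (*-identityˡ _) (*-identityˡ _) ⟨
      (1# * f 0) * (1# * g 0)  ∎
    go f g (suc n) = begin
      a * a ^ n * ((deriv f ⊛ g) n + (f ⊛ deriv g) n)
        ≈⟨ *-assoc _ _ _ ⟩
      a * (a ^ n * ((deriv f ⊛ g) n + (f ⊛ deriv g) n))
        ≈⟨ *-congˡ (distribˡ _ _ _) ⟩
      a * (scale a (deriv f ⊛ g) n + scale a (f ⊛ deriv g) n)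
        ≈⟨ *-congˡ (+-cong (go (deriv f) g n) (go f (deriv g) n)) ⟩
      a * ((scale a (deriv f) ⊛ scale a g) n + (scale a f ⊛ scale a (deriv g)) n)
        ≈⟨ distribˡ _ _ _ ⟩
      a * (scale a (deriv f) ⊛ scale a g) n + a * (scale a f ⊛ scale a (deriv g)) n
        ≈⟨ +-cong (⊛-*ˡ a _ _ n) (⊛-*ʳ a _ _ n) ⟨
      ((λ m → a * scale a (deriv f) m) ⊛ scale a g) n +
      (scale a f ⊛ (λ m → a * scale a (deriv g) m)) n
        ≈⟨ +-cong (⊛-cong (deriv-scale f) (λ _ → refl) n)
                  (⊛-cong (λ _ → refl) (deriv-scale g) n) ⟨
      (deriv (scale a f) ⊛ scale a g) n + (scale a f ⊛ deriv (scale a g)) n ∎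

  scale-exp : ∀ a q → scale a (exp q) ≋ exp (a * q)
  scale-exp a q .at n = sym (^-distrib-* a q n)

  scale-const : ∀ a b → scale a (const b) ≋ const b
  scale-const a b .at zero    = *-identityˡ _
  scale-const a b .at (suc n) = zeroʳ _

  -- Makes the semiring solver available for identities between series.
  commutativeSemiring′ : CommutativeSemiring c ℓ
  commutativeSemiring′ = record
    { Carrier = Series
    ; _≈_ = _≋_
    ; _+_ = _⊕_
    ; _*_ = _⊛_
    ; 0#  = λ _ → 0#
    ; 1#  = const 1#
    ; isCommutativeSemiring = isCommutativeSemiringˡ record
      { +-isCommutativeMonoid = record
        { isMonoid = record
          { isSemigroup = record
            { isMagma = record
              { isEquivalence = ≋-isEquivalence
              ; ∙-cong = λ p q → coeffs λ n → +-cong (p .at n) (q .at n)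
              }
            ; assoc = λ f g h → coeffs λ n → +-assoc _ _ _
            }
          ; identity = (λ f → coeffs λ n → +-identityˡ _)
                     , (λ f → coeffs λ n → +-identityʳ _)
          }
        ; comm = λ f g → coeffs λ n → +-comm _ _
        }
      ; *-isCommutativeMonoid = record
        { isMonoid = record
          { isSemigroup = record
            { isMagma = record
              { isEquivalence = ≋-isEquivalence
              ; ∙-cong = λ p q → coeffs (⊛-cong (p .at) (q .at))
              }
            ; assoc = λ f g h → coeffs (⊛-assoc f g h)
            }
          ; identity = ⊛-identityˡ
                     , (λ f → coeffs λ n →
                         trans (⊛-comm f _ n) (⊛-identityˡ f .at n))
          }
        ; comm = λ f g → coeffs (⊛-comm f g)
        }
      ; distribʳ = λ h f g → coeffs (⊛-distribʳ h f g)
      ; zeroˡ = λ f → coeffs (⊛-zeroˡ f)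
      }
    }
    where
    ≋-isEquivalence : IsEquivalence _≋_
    ≋-isEquivalence = record
      { refl  = coeffs λ n → refl
      ; sym   = λ p → coeffs λ n → sym (p .at n)
      ; trans = λ p q → coeffs λ n → trans (p .at n) (q .at n)
      }
    ⊛-identityˡ : ∀ f → const 1# ⊛ f ≋ f
    ⊛-identityˡ f .at n = trans (const-⊛ 1# f n) (*-identityˡ _)

  -- Leibniz' rule splits the coefficient into two sums, which Pascal's rule merges.
  ⊛-binomial : ∀ f g n →
    (f ⊛ g) n ≈ ∑[ k ≤ n ] ((n C toℕ k) × (f (toℕ k) * g (n ∸ toℕ k)))
  ⊛-binomial f g zero    = sym (trans (+-identityʳ _) (+-identityʳ _))
  ⊛-binomial f g (suc n) = begin
    (deriv f ⊛ g) n + (f ⊛ deriv g) n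
      ≈⟨ +-cong (⊛-binomial (deriv f) g n) (⊛-binomial f (deriv g) n) ⟩
    ∑[ k ≤ n ] ((n C toℕ k) × term (suc (toℕ k))) +
    ∑[ k ≤ n ] ((n C toℕ k) × (f (toℕ k) * g (suc (n ∸ toℕ k))))
      ≈⟨ +-congˡ (sum-cong-≋ reindex) ⟩
    ∑[ k ≤ n ] ((n C toℕ k) × term (suc (toℕ k))) +
    ∑[ k ≤ n ] ((n C toℕ (inject₁ k)) × term (toℕ (inject₁ k)))
      -- A vanishing term for k = n + 1 is appended, so that the sum can be split at its first term
      -- instead of its last.
      ≈⟨ +-congˡ (+-identityʳ _) ⟨
    ∑[ k ≤ n ] ((n C toℕ k) × term (suc (toℕ k))) +
    (∑[ k ≤ n ] ((n C toℕ (inject₁ k)) × term (toℕ (inject₁ k))) + 0#)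
      ≈⟨ +-congˡ (+-congˡ last≈0) ⟨
    ∑[ k ≤ n ] ((n C toℕ k) × term (suc (toℕ k))) +
    (∑[ k ≤ n ] ((n C toℕ (inject₁ k)) × term (toℕ (inject₁ k))) +
      (n C toℕ (fromℕ (suc n))) × term (toℕ (fromℕ (suc n))))
      ≈⟨ +-congˡ (sum-init-last {suc n} (λ k → (n C toℕ k) × term (toℕ k))) ⟨
    ∑[ k ≤ n ] ((n C toℕ k) × term (suc (toℕ k))) +
    (1 × term 0 + ∑[ k ≤ n ] ((n C suc (toℕ k)) × term (suc (toℕ k))))
      ≈⟨ swap _ _ _ ⟩
    1 × term 0 +
    (∑[ k ≤ n ] ((n C toℕ k) × term (suc (toℕ k))) +
     ∑[ k ≤ n ] ((n C suc (toℕ k)) × term (suc (toℕ k))))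
      ≈⟨ +-congˡ (∑-distrib-+ {suc n}
           (λ k → (n C toℕ k) × term (suc (toℕ k)))
           (λ k → (n C suc (toℕ k)) × term (suc (toℕ k)))) ⟨
    1 × term 0 +
    ∑[ k ≤ n ] ((n C toℕ k) × term (suc (toℕ k)) +
                (n C suc (toℕ k)) × term (suc (toℕ k)))
      ≈⟨ +-congˡ (sum-cong-≋ {suc n} pascal) ⟩
    1 × term 0 + ∑[ k ≤ n ] ((suc n C suc (toℕ k)) × term (suc (toℕ k))) ∎
    where
    open import Algebra.Properties.CommutativeSemigroup +-commutativeSemigroup
      using () renaming (x∙yz≈y∙xz to swap)
    term : ℕ → Carrier
    term k = f k * g (suc n ∸ k)

    reindex : ∀ (k : Fin (suc n)) →
      (n C toℕ k) × (f (toℕ k) * g (suc (n ∸ toℕ k))) ≈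
      (n C toℕ (inject₁ k)) × term (toℕ (inject₁ k))
    reindex k rewrite toℕ-inject₁ k | ℕ.+-∸-assoc 1 (ℕ.≤-pred (toℕ<n k)) = refl

    last≈0 : (n C toℕ (fromℕ (suc n))) × term (toℕ (fromℕ (suc n))) ≈ 0#
    last≈0 rewrite toℕ-fromℕ n | k>n⇒nCk≡0 (ℕ.n<1+n n) = refl

    pascal : ∀ (k : Fin (suc n)) →
      (n C toℕ k) × term (suc (toℕ k)) + (n C suc (toℕ k)) × term (suc (toℕ k)) ≈
      (suc n C suc (toℕ k)) × term (suc (toℕ k))
    pascal k = trans (sym (×-homo-+ _ (n C toℕ k) _))
      (×-congˡ (nCk+nC[k+1]≡[n+1]C[k+1] n (toℕ k)))

-- Sums over words and over arrangements of distinct letters.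

module ListSum {c ℓ} (R : CommutativeRing c ℓ) where
  open CommutativeRing R
  open import Algebra.Properties.CommutativeSemigroup +-commutativeSemigroup
    using () renaming (x∙yz≈y∙xz to swap)
  open import Relation.Binary.Reasoning.Setoid setoid

  ∑ : ∀ {a} {X : Set a} → List X → (X → Carrier) → Carrier
  ∑ xs f = foldr (λ x s → f x + s) 0# xs

  infix 5 [_]_
  -- The Iverson bracket, which moves a condition on the summation range into the summand.
  [_]_ : Bool → Carrier → Carrier
  [ b ] x = if b then x else 0#

  module _ {a} {X : Set a} where

    ∑-congAll : ∀ {f g : X → Carrier} {xs} →
      All (λ x → f x ≈ g x) xs → ∑ xs f ≈ ∑ xs g
    ∑-congAll []       = refl
    ∑-congAll (e ∷ es) = +-cong e (∑-congAll es)

    ∑-cong : ∀ (xs : List X) {f g} → (∀ x → f x ≈ g x) → ∑ xs f ≈ ∑ xs g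
    ∑-cong xs e = ∑-congAll (All.universal e xs)

    ∑-0 : ∀ (xs : List X) → ∑ xs (λ _ → 0#) ≈ 0#
    ∑-0 []       = refl
    ∑-0 (x ∷ xs) = trans (+-identityˡ _) (∑-0 xs)

    ∑-*ˡ : ∀ a (xs : List X) f → ∑ xs (λ x → a * f x) ≈ a * ∑ xs f
    ∑-*ˡ a []       f = sym (zeroʳ a)
    ∑-*ˡ a (x ∷ xs) f = trans (+-congˡ (∑-*ˡ a xs f)) (sym (distribˡ _ _ _))

    ∑-++ : ∀ (xs ys : List X) f → ∑ (xs ++ ys) f ≈ ∑ xs f + ∑ ys f
    ∑-++ []       ys f = sym (+-identityˡ _)
    ∑-++ (x ∷ xs) ys f = trans (+-congˡ (∑-++ xs ys f)) (sym (+-assoc _ _ _))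

    ∑-ʳ++ : ∀ (xs ys : List X) f → ∑ (xs ʳ++ ys) f ≈ ∑ xs f + ∑ ys f
    ∑-ʳ++ []       ys f = sym (+-identityˡ _)
    ∑-ʳ++ (x ∷ xs) ys f = trans (∑-ʳ++ xs (x ∷ ys) f)
      (trans (swap _ _ _) (sym (+-assoc _ _ _)))

    ∑-map : ∀ {b} {Y : Set b} (g : Y → X) ys f → ∑ (map g ys) f ≈ ∑ ys (f ∘ g)
    ∑-map g []       f = refl
    ∑-map g (y ∷ ys) f = +-congˡ (∑-map g ys f)

    ∑-filter : ∀ {p} {P : X → Set p} (P? : Unary.Decidable P) xs f →
               ∑ (filter P? xs) f ≈ ∑ xs (λ x → [ does (P? x) ] f x)
    ∑-filter P? []       f = refl
    ∑-filter P? (x ∷ xs) f with does (P? x)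
    ... | true  = +-congˡ (∑-filter P? xs f)
    ... | false = trans (∑-filter P? xs f) (sym (+-identityˡ _))

    ∑-[] : ∀ b (xs : List X) f → [ b ] ∑ xs f ≈ ∑ xs (λ x → [ b ] f x)
    ∑-[] true  xs f = refl
    ∑-[] false xs f = sym (∑-0 xs)

  []-cong : ∀ b {x y} → x ≈ y → [ b ] x ≈ [ b ] y
  []-cong true  e = e
  []-cong false e = refl

  []-∧ : ∀ b c x → [ b ∧ c ] x ≈ [ b ] [ c ] x
  []-∧ true  c x = refl
  []-∧ false c x = refl

  infixl 6 _∖_
  _∖_ : List ℕ → ℕ → List ℕ
  L ∖ x = filter (λ z → ¬? (x ℕ.≟ z)) L

  -- For the alphabet 1, ..., n this is `𝔖 n` by definition; a general alphabet allows letters to be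
  -- used up one at a time.
  arrangements : List ℕ → ℕ → List (List ℕ)
  arrangements L n = filter (unique? ℕ._≟_) (words L n)

  ∑-words : ∀ L n f →
    ∑ (words L (suc n)) f ≈ ∑ L (λ x → ∑ (words L n) (λ π → f (x ∷ π)))
  ∑-words L n f = go L
    where
    go : ∀ xs → ∑ (cartesianProductWith _∷_ xs (words L n)) f ≈
                ∑ xs (λ x → ∑ (words L n) (λ π → f (x ∷ π)))
    go []       = refl
    go (x ∷ xs) = trans (∑-++ (map (x ∷_) (words L n)) _ f)
      (+-cong (∑-map (x ∷_) (words L n) f) (go xs))

  -- This is the test that `unique?` makes on a head `x`, so `does` of `unique?` at `x ∷ π` reduces
  -- to a conjunction that begins with it.
  avoids : ∀ x → Unary.Decidable (All (x ≢_))
  avoids x = All.all? (λ z → ¬? (x ℕ.≟ z))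

  -- Trades the condition that the rest of a word avoids its first letter for a smaller alphabet.
  ∑-words-∖ : ∀ L x n f →
    ∑ (words (L ∖ x) n) f ≈ ∑ (words L n) (λ π → [ does (avoids x π) ] f π)
  ∑-words-∖ L x zero    f = refl
  ∑-words-∖ L x (suc n) f = begin
    ∑ (words (L ∖ x) (suc n)) f
      ≈⟨ ∑-words (L ∖ x) n f ⟩
    ∑ (L ∖ x) (λ z → ∑ (words (L ∖ x) n) (λ π → f (z ∷ π)))
      ≈⟨ ∑-filter (λ z → ¬? (x ℕ.≟ z)) L _ ⟩
    ∑ L (λ z → [ does (¬? (x ℕ.≟ z)) ] ∑ (words (L ∖ x) n) (λ π → f (z ∷ π)))
      ≈⟨ ∑-cong L (λ z → step z (does (¬? (x ℕ.≟ z)))) ⟩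
    ∑ L (λ z → ∑ (words L n) (λ π → [ does (avoids x (z ∷ π)) ] f (z ∷ π)))
      ≈⟨ ∑-words L n _ ⟨
    ∑ (words L (suc n)) (λ π → [ does (avoids x π) ] f π) ∎
    where
    step : ∀ z b → [ b ] ∑ (words (L ∖ x) n) (λ π → f (z ∷ π)) ≈
      ∑ (words L n) (λ π → [ b ∧ does (avoids x π) ] f (z ∷ π))
    step z b = begin
      [ b ] ∑ (words (L ∖ x) n) (λ π → f (z ∷ π))
        ≈⟨ []-cong b (∑-words-∖ L x n _) ⟩
      [ b ] ∑ (words L n) (λ π → [ does (avoids x π) ] f (z ∷ π))
        ≈⟨ ∑-[] b (words L n) _ ⟩
      ∑ (words L n) (λ π → [ b ] [ does (avoids x π) ] f (z ∷ π))
        ≈⟨ ∑-cong (words L n) (λ π → []-∧ b _ _) ⟨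
      ∑ (words L n) (λ π → [ b ∧ does (avoids x π) ] f (z ∷ π)) ∎

  -- The letters of `x ∷ π` are distinct when `π` avoids `x` and has distinct letters itself;
  -- `∑-words-∖` absorbs the first condition into the alphabet.
  ∑-arrangements : ∀ L n f →
    ∑ (arrangements L (suc n)) f ≈
    ∑ L (λ x → ∑ (arrangements (L ∖ x) n) (λ π → f (x ∷ π)))
  ∑-arrangements L n f = begin
    ∑ (arrangements L (suc n)) f
      ≈⟨ ∑-filter (unique? ℕ._≟_) (words L (suc n)) f ⟩
    ∑ (words L (suc n)) (λ π → [ does (unique? ℕ._≟_ π) ] f π)
      ≈⟨ ∑-words L n _ ⟩
    ∑ L (λ x → ∑ (words L n) (λ π → [ does (unique? ℕ._≟_ (x ∷ π)) ] f (x ∷ π)))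
      ≈⟨ ∑-cong L (λ x → ∑-cong (words L n) (λ π → []-∧ (does (avoids x π)) _ _)) ⟩
    ∑ L (λ x → ∑ (words L n) (λ π →
      [ does (avoids x π) ] [ does (unique? ℕ._≟_ π) ] f (x ∷ π)))
      ≈⟨ ∑-cong L (λ x → ∑-words-∖ L x n _) ⟨
    ∑ L (λ x → ∑ (words (L ∖ x) n) (λ π → [ does (unique? ℕ._≟_ π) ] f (x ∷ π)))
      ≈⟨ ∑-cong L (λ x → ∑-filter (unique? ℕ._≟_) (words (L ∖ x) n) _) ⟨
    ∑ L (λ x → ∑ (arrangements (L ∖ x) n) (λ π → f (x ∷ π))) ∎

  -- Matching step weights with peaks and valleys takes distinct letters, and the exponent of a
  -- weight per letter takes the length.
  ∑-arrangements-cong : ∀ L n {f g : List ℕ → Carrier} →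
    (∀ π → Unique π → length π ≡ n → f π ≈ g π) →
    ∑ (arrangements L n) f ≈ ∑ (arrangements L n) g
  ∑-arrangements-cong L n e = ∑-congAll
    (All.zipWith (λ (p , u) → e _ u p)
      ( All.filter⁺ (unique? ℕ._≟_) (length-words n)
      , All.all-filter (unique? ℕ._≟_) (words L n)))
    where
    length-words : ∀ n → All (λ π → length π ≡ n) (words L n)
    length-words zero    = ≡.refl ∷ []
    length-words (suc n) =
      All.cartesianProductWith⁺ (≡-setoid _) (≡-setoid _) _∷_ L (words L n)
        (λ _ p → ≡.cong suc (All.lookup (length-words n) p))

  -- A cursor in the increasing list `ls ʳ++ rs` of letters still to come. Both sides list the
  -- letters nearest to the cursor first, so moving it past a letter leaves that list definitionally
  -- unchanged.
  record Zipper (ls rs : List ℕ) : Set where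
    constructor zipper
    field
      descending : AllPairs _>_ ls
      ascending  : AllPairs _<_ rs
      separated  : All (λ l → All (l <_) rs) ls

  zip-right : ∀ {x ls rs} → Zipper (x ∷ ls) rs → Zipper ls (x ∷ rs)
  zip-right (zipper (x> ∷ ds) as (x< ∷ ss)) =
    zipper ds (x< ∷ as) (All.zipWith (λ (p , q) → p ∷ q) (x> , ss))

  zip-left : ∀ {x ls rs} → Zipper ls (x ∷ rs) → Zipper (x ∷ ls) rs
  zip-left (zipper ds (x< ∷ as) ss) =
    zipper (All.map All.head ss ∷ ds) as (x< ∷ All.map All.tail ss)

  ∖-ʳ++ : ∀ {x} ls {rs} → All (_< x) ls → All (x <_) rs →
          (ls ʳ++ (x ∷ rs)) ∖ x ≡ ls ʳ++ rs
  ∖-ʳ++ {x} ls {rs} ls<x x<rs =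
    ≡.trans (filter-ʳ++ ls (x ∷ rs))
      (≡.cong₂ _ʳ++_ (filter-all ≢x? (All.map (λ p q → ℕ.<-irrefl (≡.sym q) p) ls<x))
        (≡.trans (filter-reject ≢x? (λ p → p ≡.refl))
          (filter-all ≢x? (All.map ℕ.<⇒≢ x<rs))))
    where
    ≢x? = λ z → ¬? (x ℕ.≟ z)
    filter-ʳ++ : ∀ ls rs → (ls ʳ++ rs) ∖ x ≡ (ls ∖ x) ʳ++ (rs ∖ x)
    filter-ʳ++ []       rs = ≡.refl
    filter-ʳ++ (l ∷ ls) rs with filter-ʳ++ ls (l ∷ rs)
    ... | e with does (¬? (x ℕ.≟ l))
    ... | true  = e
    ... | false = e

-- Sums of products of step weights over permutations.

-- The Boolean state records whether the last step was a descent.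
module Transfer {c ℓ} (R : CommutativeRing c ℓ)
  (w : Bool → Bool → CommutativeRing.Carrier R) (e : CommutativeRing.Carrier R) where
  open CommutativeRing R
  open ListSum R
  open Hurwitz R
  open import Algebra.Properties.Semiring.Exp semiring using (_^_)
  open import Algebra.Solver.Ring.NaturalCoefficients.Default commutativeSemiring
  open import Relation.Binary.Reasoning.Setoid setoid

  weight : Bool → ℕ → List ℕ → Carrier
  weight s a []      = e
  weight s a (x ∷ π) = w s (x <ᵇ a) * weight (x <ᵇ a) x π

  -- The first letter is read as if an ascent led to it, in accordance with the convention π₀ = 0
  -- behind left peaks.
  weight₁ : List ℕ → Carrier
  weight₁ []      = 0#
  weight₁ (x ∷ π) = weight false x π

  -- Sums over the choice of the next letter, starting from the nearest one. Every letter passed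
  -- over moves to the other side of the next letter, so neighbouring values of the sum differ by a
  -- single value of `f`.
  below above : (ℕ → ℕ → Carrier) → ℕ → ℕ → Carrier
  below f zero    b = 0#
  below f (suc a) b = f a b + below f a (suc b)
  above f a zero    = 0#
  above f a (suc b) = f a b + above f (suc a) b

  -- Meaningful for n = a + b, the numbers of letters below and above the last
  -- letter read.
  total : ℕ → Bool → ℕ → ℕ → Carrier
  total zero    s a b = e
  total (suc n) s a b =
    w s true * below (total n true) a b + w s false * above (total n false) a b

  -- Simultaneous induction with the two sums below: a first letter from `ls` is a descent, one from
  -- `rs` an ascent, and removing it leaves a zipper at that letter. The letters themselves then
  -- matter only through the two lengths.
  ∑-weight : ∀ n s a {ls rs} → Zipper ls rs → All (_< a) ls → All (a <_) rs →
    ∑ (arrangements (ls ʳ++ rs) n) (weight s a) ≈ total n s (length ls) (length rs)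
  ∑-below : ∀ n {ls rs} → Zipper ls rs →
    ∑ ls (λ x → ∑ (arrangements ((ls ʳ++ rs) ∖ x) n) (weight true x)) ≈
    below (total n true) (length ls) (length rs)
  ∑-above : ∀ n {ls rs} → Zipper ls rs →
    ∑ rs (λ x → ∑ (arrangements ((ls ʳ++ rs) ∖ x) n) (weight false x)) ≈
    above (total n false) (length ls) (length rs)

  ∑-weight zero    s a z ls<a a<rs = +-identityʳ e
  ∑-weight (suc n) s a {ls} {rs} z ls<a a<rs = begin
    ∑ (arrangements L (suc n)) (weight s a)
      ≈⟨ ∑-arrangements L n (weight s a) ⟩
    ∑ L first
      ≈⟨ ∑-ʳ++ ls rs first ⟩
    ∑ ls first + ∑ rs first
      ≈⟨ +-cong (∑-congAll (All.map down ls<a)) (∑-congAll (All.map up a<rs)) ⟩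
    ∑ ls (λ x → w s true * rest true x) + ∑ rs (λ x → w s false * rest false x)
      ≈⟨ +-cong (∑-*ˡ _ ls (rest true)) (∑-*ˡ _ rs (rest false)) ⟩
    w s true * ∑ ls (rest true) + w s false * ∑ rs (rest false)
      ≈⟨ +-cong (*-congˡ (∑-below n z)) (*-congˡ (∑-above n z)) ⟩
    total (suc n) s (length ls) (length rs) ∎
    where
    L : List ℕ
    L = ls ʳ++ rs

    first : ℕ → Carrier
    first x = ∑ (arrangements (L ∖ x) n) (λ π → weight s a (x ∷ π))

    rest : Bool → ℕ → Carrier
    rest d x = ∑ (arrangements (L ∖ x) n) (weight d x)

    step : ∀ d {x} → (x <ᵇ a) ≡ d → first x ≈ w s d * rest d x
    step d ≡.refl = ∑-*ˡ _ (arrangements (L ∖ _) n) _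

    down : ∀ {x} → x < a → first x ≈ w s true * rest true x
    down x<a = step true (<⇒<ᵇ≡true x<a)

    up : ∀ {x} → a < x → first x ≈ w s false * rest false x
    up a<x = step false (>⇒<ᵇ≡false a<x)

  ∑-below n {[]}     z = refl
  ∑-below n {x ∷ ls} {rs} z@(zipper (x> ∷ ds) as (x< ∷ ss)) = +-cong
    (trans (reflexive (≡.cong (λ L → ∑ (arrangements L n) (weight true x))
                              (∖-ʳ++ ls x> x<)))
      (∑-weight n true x (zipper ds as ss) x> x<))
    (∑-below n (zip-right z))

  ∑-above n {ls} {[]}     z = refl
  ∑-above n {ls} {x ∷ rs} z@(zipper ds (x< ∷ as) ss) = +-cong
    (trans (reflexive (≡.cong (λ L → ∑ (arrangements L n) (weight false x))
                              (∖-ʳ++ ls x> x<)))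
      (∑-weight n false x (zipper ds as (All.map All.tail ss)) x> x<))
    (∑-above n (zip-left z))
    where x> = All.map All.head ss

  -- Reading starts below all letters, so the zipper has an empty left side and the first letter
  -- counts as an ascent.
  ∑𝔖-weight : ∀ n → ∑ (𝔖 (suc n)) weight₁ ≈ above (total n false) 0 (suc n)
  ∑𝔖-weight n = begin
    ∑ (𝔖 (suc n)) weight₁
      ≈⟨ ∑-arrangements L n weight₁ ⟩
    ∑ L (λ x → ∑ (arrangements (L ∖ x) n) (weight false x))
      ≈⟨ ∑-above n (zipper [] increasing []) ⟩
    above (total n false) 0 (length L)
      ≡⟨ ≡.cong (above (total n false) 0) length-L ⟩
    above (total n false) 0 (suc n) ∎
    where
    L : List ℕ
    L = map suc (upTo (suc n))

    increasing : AllPairs _<_ L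
    increasing = AllPairs.map⁺ (AllPairs.applyUpTo⁺₁ _ (suc n) (λ i<j _ → s≤s i<j))

    length-L : length L ≡ suc n
    length-L = ≡.trans (length-map suc (upTo (suc n))) (length-upTo (suc n))

  -- d₀ and u₀ extend the two parts of total to the empty word.
  module Solution (d₀ u₀ : Carrier)
    (e≈ : ∀ s → e ≈ w s true * d₀ + w s false * u₀) where

    D U : ℕ → ℕ → ℕ → Carrier
    D zero    a b = d₀
    D (suc n) a b = below (total n true) a b
    U zero    a b = u₀
    U (suc n) a b = above (total n false) a b

    total≈ : ∀ n s a b → total n s a b ≈ w s true * D n a b + w s false * U n a b
    total≈ zero    s a b = e≈ s
    total≈ (suc n) s a b = refl

    module _ {l : ℕ → ℕ → ℕ → Carrier} {q : Carrier}
      (step : ∀ n a b → l (suc n) (suc a) b ≈ l (suc n) a (suc b) + q * l n a b) where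

      -- Leibniz' rule for `exp q ⊛ h` has the shape of `step`: differentiating `exp q` gives the
      -- factor `q`, and differentiating `h` moves one letter from `a` to `b`. Hence the boundary
      -- values at a = 0 determine those at b = 0.
      exp-recurrence : ∀ n → l n n 0 ≈ (exp q ⊛ (λ m → l m 0 m)) n
      exp-recurrence n = sym (trans
        (go n 0 (λ m → reflexive (≡.cong (λ k → l k 0 k) (≡.sym (ℕ.+-identityʳ m)))))
        (reflexive (≡.cong (λ k → l k n 0) (ℕ.+-identityʳ n))))
        where
        -- For the induction `h` is a derivative of order `b` of the boundary sequence.
        go : ∀ a b {h} → (∀ m → h m ≈ l (m ℕ.+ b) 0 (m ℕ.+ b)) →
             (exp q ⊛ h) a ≈ l (a ℕ.+ b) a b
        go zero    b h≈ = trans (*-identityˡ _) (h≈ 0)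
        go (suc a) b {h} h≈ = begin
          ((λ m → q * exp q m) ⊛ h) a + (exp q ⊛ deriv h) a
            ≈⟨ +-cong (⊛-*ˡ q (exp q) h a) refl ⟩
          q * (exp q ⊛ h) a + (exp q ⊛ deriv h) a
            ≈⟨ +-cong (*-congˡ (go a b h≈)) (go a (suc b) deriv-h≈) ⟩
          q * l (a ℕ.+ b) a b + l (a ℕ.+ suc b) a (suc b)
            ≈⟨ +-comm _ _ ⟩
          l (a ℕ.+ suc b) a (suc b) + q * l (a ℕ.+ b) a b
            ≡⟨ ≡.cong (λ k → l k a (suc b) + q * l (a ℕ.+ b) a b) (ℕ.+-suc a b) ⟩
          l (suc (a ℕ.+ b)) a (suc b) + q * l (a ℕ.+ b) a b
            ≈⟨ step (a ℕ.+ b) a b ⟨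
          l (suc (a ℕ.+ b)) (suc a) b ∎
          where
          deriv-h≈ : ∀ m → deriv h m ≈ l (m ℕ.+ suc b) 0 (m ℕ.+ suc b)
          deriv-h≈ m = trans (h≈ (suc m))
            (reflexive (≡.cong (λ k → l k 0 k) (≡.sym (ℕ.+-suc m b))))

    combination : Carrier → Carrier → ℕ → ℕ → ℕ → Carrier
    combination α β n a b = α * D n a b + β * U n a b

    -- (α, β) is a left eigenvector, for the eigenvalue q, of the matrix of w
    -- with the second row negated ...
    forward : ∀ α β q →
      α * w true true  ≈ β * w false true + q * α →
      α * w true false ≈ β * w false false + q * β →
      ∀ n → combination α β n n 0 ≈ (exp q ⊛ (λ m → combination α β m 0 m)) n
    forward α β q p₁ p₂ = exp-recurrence step
      where
      step : ∀ n a b → combination α β (suc n) (suc a) b ≈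
        combination α β (suc n) a (suc b) + q * combination α β n a b
      step n a b = begin
        α * (total n true a b + d) + β * u
          ≈⟨ +-congʳ (*-congˡ (+-congʳ (total≈ n true a b))) ⟩
        α * ((w true true * d′ + w true false * u′) + d) + β * u
          ≈⟨ solve 8 (λ α β x y d u d′ u′ →
               α :* ((x :* d′ :+ y :* u′) :+ d) :+ β :* u :=
               (α :* x) :* d′ :+ (α :* y) :* u′ :+ (α :* d :+ β :* u))
               refl α β (w true true) (w true false) d u d′ u′ ⟩
        (α * w true true) * d′ + (α * w true false) * u′ + (α * d + β * u)
          ≈⟨ +-congʳ (+-cong (*-congʳ p₁) (*-congʳ p₂)) ⟩
        (β * w false true + q * α) * d′ + (β * w false false + q * β) * u′ + (α * d + β * u)
          ≈⟨ solve 9 (λ α β x y d u d′ u′ q →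
               (β :* x :+ q :* α) :* d′ :+ (β :* y :+ q :* β) :* u′ :+ (α :* d :+ β :* u) :=
               α :* d :+ β :* ((x :* d′ :+ y :* u′) :+ u) :+ q :* (α :* d′ :+ β :* u′))
               refl α β (w false true) (w false false) d u d′ u′ q ⟩
        α * d + β * ((w false true * d′ + w false false * u′) + u) + q * (α * d′ + β * u′)
          ≈⟨ +-congʳ (+-congˡ (*-congˡ (+-congʳ (total≈ n false a b)))) ⟨
        α * d + β * (total n false a b + u) + q * combination α β n a b ∎
        where
        d  = D (suc n) a (suc b)
        u  = U (suc n) (suc a) b
        d′ = D n a b
        u′ = U n a b

    -- ... and here for the eigenvalue - q, stated without negation.
    backward : ∀ α β q →
      β * w false true  ≈ α * w true true + q * α →
      β * w false false ≈ α * w true false + q * β →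
      ∀ n → combination α β n 0 n ≈ (exp q ⊛ (λ m → combination α β m m 0)) n
    backward α β q p₁ p₂ =
      -- With the two counts exchanged, the same recurrence leads from b = 0 to a = 0.
      exp-recurrence {l = λ n a b → combination α β n b a} (λ n a b → step n b a)
      where
      step : ∀ n a b → combination α β (suc n) a (suc b) ≈
        combination α β (suc n) (suc a) b + q * combination α β n a b
      step n a b = begin
        α * d + β * (total n false a b + u)
          ≈⟨ +-congˡ (*-congˡ (+-congʳ (total≈ n false a b))) ⟩
        α * d + β * ((w false true * d′ + w false false * u′) + u)
          ≈⟨ solve 8 (λ α β x y d u d′ u′ →
               α :* d :+ β :* ((x :* d′ :+ y :* u′) :+ u) :=
               (β :* x) :* d′ :+ (β :* y) :* u′ :+ (α :* d :+ β :* u))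
               refl α β (w false true) (w false false) d u d′ u′ ⟩
        (β * w false true) * d′ + (β * w false false) * u′ + (α * d + β * u)
          ≈⟨ +-congʳ (+-cong (*-congʳ p₁) (*-congʳ p₂)) ⟩
        (α * w true true + q * α) * d′ + (α * w true false + q * β) * u′ + (α * d + β * u)
          ≈⟨ solve 9 (λ α β x y d u d′ u′ q →
               (α :* x :+ q :* α) :* d′ :+ (α :* y :+ q :* β) :* u′ :+ (α :* d :+ β :* u) :=
               α :* ((x :* d′ :+ y :* u′) :+ d) :+ β :* u :+ q :* (α :* d′ :+ β :* u′))
               refl α β (w true true) (w true false) d u d′ u′ q ⟩
        α * ((w true true * d′ + w true false * u′) + d) + β * u + q * (α * d′ + β * u′)
          ≈⟨ +-congʳ (+-congʳ (*-congˡ (+-congʳ (total≈ n true a b)))) ⟨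
        α * (total n true a b + d) + β * u + q * combination α β n a b ∎
        where
        d  = D (suc n) a (suc b)
        u  = U (suc n) (suc a) b
        d′ = D n a b
        u′ = U n a b

-- The generating function of the Eulerian polynomials.

module Eulerian {c ℓ} (R : CommutativeRing c ℓ) where
  open CommutativeRing R
  open Enumerators R using (A)
  open Hurwitz R
  open ListSum R
  open import Algebra.Properties.Semiring.Exp semiring using (_^_; ^-homo-*)
  open import Algebra.Solver.Ring.NaturalCoefficients.Default commutativeSemiring
  open import Relation.Binary.Reasoning.Setoid setoid

  module _ (x q : Carrier) (q+x≈1 : q + x ≈ 1#) where

    private
      step : Bool → Bool → Carrier
      step s d = x ^ count d

    open Transfer R step 1#
    -- The empty completion is counted as an ascent, which has weight 1 in either state.
    open Solution 0# 1# (λ s →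
      solve 1 (λ x → con 1 := (x :* con 1) :* con 0 :+ con 1 :* con 1) refl x)

    weight≈ : ∀ s a π → weight s a π ≈ x ^ des (a ∷ π)
    weight≈ s a []      = refl
    weight≈ s a (b ∷ π) = trans (*-congˡ (weight≈ (b <ᵇ a) b π))
      (sym (^-homo-* x (count (b <ᵇ a)) (des (b ∷ π))))

    A≈xU : ∀ n → A (suc n) x ≈ x * U (suc n) 0 (suc n)
    A≈xU n = begin
      ∑ (𝔖 (suc n)) (λ π → x ^ (des π ℕ.+ 1))
        ≈⟨ ∑-arrangements-cong (map suc (upTo (suc n))) (suc n) term≈ ⟩
      ∑ (𝔖 (suc n)) (λ π → x * weight₁ π)
        ≈⟨ ∑-*ˡ x (𝔖 (suc n)) weight₁ ⟩
      x * ∑ (𝔖 (suc n)) weight₁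
        ≈⟨ *-congˡ (∑𝔖-weight n) ⟩
      x * U (suc n) 0 (suc n) ∎
      where
      term≈ : ∀ π → Unique π → length π ≡ suc n → x ^ (des π ℕ.+ 1) ≈ x * weight₁ π
      term≈ (a ∷ π) _ _ = begin
        x ^ (des (a ∷ π) ℕ.+ 1)  ≡⟨ ≡.cong (x ^_) (ℕ.+-comm (des (a ∷ π)) 1) ⟩
        x * x ^ des (a ∷ π)      ≈⟨ *-congˡ (weight≈ false a π) ⟨
        x * weight false a π     ∎

    -- The vector (1, 1) has eigenvalue 0, so `D + U` depends only on a + b for a given index. At b
    -- = 0 the part `U` vanishes, at a = 0 the part `D`.
    D≈U : ∀ n → D (suc n) (suc n) 0 ≈ U (suc n) 0 (suc n)
    D≈U n = begin
      D (suc n) (suc n) 0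
        ≈⟨ solve 1 (λ d → d := con 1 :* d :+ con 1 :* con 0) refl _ ⟩
      combination 1# 1# (suc n) (suc n) 0
        ≈⟨ forward 1# 1# 0# (invariant _) (invariant _) (suc n) ⟩
      (exp 0# ⊛ (λ m → combination 1# 1# m 0 m)) (suc n)
        ≈⟨ ⊛-cong (exp-0 .at) (λ _ → refl) (suc n) ⟩
      (const 1# ⊛ (λ m → combination 1# 1# m 0 m)) (suc n)
        ≈⟨ const-⊛ 1# _ (suc n) ⟩
      1# * combination 1# 1# (suc n) 0 (suc n)
        ≈⟨ solve 1 (λ u → con 1 :* (con 1 :* con 0 :+ con 1 :* u) := u) refl _ ⟩
      U (suc n) 0 (suc n) ∎
      where
      invariant : ∀ z → 1# * z ≈ 1# * z + 0# * 1#
      invariant = solve 1 (λ z → con 1 :* z := con 1 :* z :+ con 0 :* con 1) refl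

    -- This is the classical generating function q / (1 - x e^(q z)), with z marking the length. It
    -- comes from the eigenvector (x, 1) for - q: its combination at b = 0 is A by `D≈U`, and x
    -- times the one at a = 0 is A as well, except for the constant term, where q + x = 1 supplies
    -- q.
    A-equation : ∀ n →
      A n x ≈ const q n + x * (exp q ⊛ (λ m → A m x)) n
    A-equation n = begin
      A n x
        ≈⟨ split n ⟩
      const q n + x * combination x 1# n 0 n
        ≈⟨ +-congˡ (*-congˡ (backward x 1# q
             (trans (eigen _) (+-congˡ (*-congˡ (*-identityʳ x)))) (eigen _) n)) ⟩
      const q n + x * (exp q ⊛ (λ m → combination x 1# m m 0)) n
        ≈⟨ +-congˡ (*-congˡ (⊛-cong (λ _ → refl) A≈ n)) ⟨
      const q n + x * (exp q ⊛ (λ m → A m x)) n ∎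
      where
      eigen : ∀ z → 1# * z ≈ x * z + q * z
      eigen z = trans (*-congʳ (sym q+x≈1))
        (trans (distribʳ z q x) (+-comm _ _))

      split : ∀ n → A n x ≈ const q n + x * combination x 1# n 0 n
      split zero    = trans (sym q+x≈1) (solve 2 (λ q x →
        q :+ x := q :+ x :* (x :* con 0 :+ con 1 :* con 1)) refl q x)
      split (suc n) = trans (A≈xU n) (solve 2 (λ x u →
        x :* u := con 0 :+ x :* (x :* con 0 :+ con 1 :* u)) refl x _)

      A≈ : ∀ n → A n x ≈ combination x 1# n n 0
      A≈ zero    = solve 1 (λ x → con 1 := x :* con 0 :+ con 1 :* con 1) refl x
      A≈ (suc n) = begin
        A (suc n) x                         ≈⟨ A≈xU n ⟩
        x * U (suc n) 0 (suc n)             ≈⟨ *-congˡ (D≈U n) ⟨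
        x * D (suc n) (suc n) 0             ≈⟨ solve 2 (λ x d →
                                                 x :* d := x :* d :+ con 1 :* con 0) refl x _ ⟩
        combination x 1# (suc n) (suc n) 0  ∎

-- Left peaks, valleys and descents as products of step weights.

<ᵇ-flip : ∀ {m n} → m ≢ n → (m <ᵇ n) ≡ not (n <ᵇ m)
<ᵇ-flip {m} {n} m≢n with ℕ.<-cmp m n
... | tri< m<n _ _ = ≡.trans (<⇒<ᵇ≡true m<n) (≡.cong not (≡.sym (>⇒<ᵇ≡false m<n)))
... | tri≈ _ m≡n _ = ⊥-elim (m≢n m≡n)
... | tri> _ _ m>n = ≡.trans (>⇒<ᵇ≡false m>n) (≡.cong not (≡.sym (<⇒<ᵇ≡true m>n)))

module PeakValleyDescent {c ℓ} (R : CommutativeRing c ℓ)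
  (Y Z T u e : CommutativeRing.Carrier R) where
  open CommutativeRing R
  open Enumerators R using (P)
  open ListSum R
  open import Algebra.Properties.Semiring.Exp semiring using (_^_; ^-homo-*)
  open import Algebra.Solver.Ring.NaturalCoefficients.Default commutativeSemiring
  open import Relation.Binary.Reasoning.Setoid setoid

  -- A peak is a descent after an ascent, a valley an ascent after a descent. The factor `u` per
  -- step produces the power of 1 + y t² in the identity and clears denominators.
  step : Bool → Bool → Carrier
  step s d = u * (Y ^ count (not s ∧ d) * Z ^ count (s ∧ not d) * T ^ count d)

  open Transfer R step e public

  private
    term : ℕ → ℕ → ℕ → ℕ → Carrier
    term l i j k = e * u ^ l * (Y ^ i * Z ^ j * T ^ k)

    step-term : ∀ s d l i j k → step s d * term l i j k ≈
      term (suc l) (count (not s ∧ d) ℕ.+ i) (count (s ∧ not d) ℕ.+ j) (count d ℕ.+ k)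
    step-term s d l i j k = begin
      u * (Y ^ i′ * Z ^ j′ * T ^ k′) * (e * u ^ l * (Y ^ i * Z ^ j * T ^ k))
        ≈⟨ solve 9 (λ u e ul y z t y′ z′ t′ →
             u :* (y′ :* z′ :* t′) :* (e :* ul :* (y :* z :* t)) :=
             e :* (u :* ul) :* ((y′ :* y) :* (z′ :* z) :* (t′ :* t)))
             refl u e (u ^ l) (Y ^ i) (Z ^ j) (T ^ k) (Y ^ i′) (Z ^ j′) (T ^ k′) ⟩
      e * (u * u ^ l) * ((Y ^ i′ * Y ^ i) * (Z ^ j′ * Z ^ j) * (T ^ k′ * T ^ k))
        ≈⟨ *-congˡ (*-cong (*-cong (^-homo-* Y i′ i) (^-homo-* Z j′ j)) (^-homo-* T k′ k)) ⟨
      term (suc l) (i′ ℕ.+ i) (j′ ℕ.+ j) (k′ ℕ.+ k) ∎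
      where
      i′ = count (not s ∧ d)
      j′ = count (s ∧ not d)
      k′ = count d

    e≈term : e ≈ term 0 0 0 0
    e≈term = solve 1 (λ e → e := e :* con 1 :* (con 1 :* con 1 :* con 1)) refl e

  -- The letter `a` before `b` still decides whether `b` is a peak or a valley, but the step from
  -- `a` to `b` was weighted when `b` was read; hence `des` starts at `b`.
  weight≈ : ∀ a b π → a ≢ b → Unique (b ∷ π) →
    weight (b <ᵇ a) b π ≈
    term (length π) (pk (a ∷ b ∷ π)) (val (a ∷ b ∷ π)) (des (b ∷ π))
  weight≈ a b []      a≢b _ = e≈term
  weight≈ a b (c ∷ π) a≢b ((b≢c ∷ _) ∷ u)
    -- `pk` and `val` compare neighbours in both orders; for distinct letters each comparison is the
    -- negation of a state.
    rewrite <ᵇ-flip a≢b | <ᵇ-flip b≢c =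
    trans (*-congˡ (weight≈ b c π b≢c u))
      (step-term (b <ᵇ a) (c <ᵇ b) (length π)
        (pk (b ∷ c ∷ π)) (val (b ∷ c ∷ π)) (des (c ∷ π)))

  -- In the initial state `false` the first step contributes `Y` exactly when it is a descent, which
  -- is the left peak at position 1.
  weight₁≈ : ∀ a π → Unique (a ∷ π) →
    weight false a π ≈
    term (length π) (lpk (a ∷ π)) (val (a ∷ π)) (des (a ∷ π))
  weight₁≈ a []      _ = e≈term
  weight₁≈ a (b ∷ π) ((a≢b ∷ _) ∷ u) =
    trans (*-congˡ (weight≈ a b π a≢b u))
      (step-term false (b <ᵇ a) (length π)
        (pk (a ∷ b ∷ π)) (val (a ∷ b ∷ π)) (des (b ∷ π)))

  above≈P : ∀ n → above (total n false) 0 (suc n) ≈ e * u ^ n * P (suc n) Y Z T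
  above≈P n = begin
    above (total n false) 0 (suc n)
      ≈⟨ ∑𝔖-weight n ⟨
    ∑ (𝔖 (suc n)) weight₁
      ≈⟨ ∑-arrangements-cong (map suc (upTo (suc n))) (suc n) term≈ ⟩
    ∑ (𝔖 (suc n)) (λ π → e * u ^ n * (Y ^ lpk π * Z ^ val π * T ^ des π))
      ≈⟨ ∑-*ˡ (e * u ^ n) (𝔖 (suc n)) _ ⟩
    e * u ^ n * P (suc n) Y Z T ∎
    where
    term≈ : ∀ π → Unique π → length π ≡ suc n →
      weight₁ π ≈ e * u ^ n * (Y ^ lpk π * Z ^ val π * T ^ des π)
    term≈ (a ∷ π) u p = trans (weight₁≈ a π u)
      (reflexive (≡.cong (λ l → term l (lpk (a ∷ π)) (val (a ∷ π)) (des (a ∷ π)))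
        (ℕ.suc-injective p)))

-- Cancellable ring elements.

module Cancellation {c ℓ} (R : CommutativeRing c ℓ) where
  open CommutativeRing R
  open import Relation.Binary.Reasoning.Setoid setoid

  Cancellable : Carrier → Set (c ⊔ ℓ)
  Cancellable a = ∀ {x z} → a * x ≈ a * z → x ≈ z

  leftInverse⇒cancellable : ∀ {a i} → i * a ≈ 1# → Cancellable a
  leftInverse⇒cancellable {a} {i} ia≈1 {x} {z} ax≈az = begin
    x            ≈⟨ undo x ⟨
    i * (a * x)  ≈⟨ *-congˡ ax≈az ⟩
    i * (a * z)  ≈⟨ undo z ⟩
    z            ∎
    where
    undo : ∀ x → i * (a * x) ≈ x
    undo x = trans (sym (*-assoc i a x)) (trans (*-congʳ ia≈1) (*-identityˡ x))

-- The identity over a commutative ring, with denominators cleared.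

module Identity {c ℓ} (R : CommutativeRing c ℓ) where
  open CommutativeRing R
  open Cancellation R
  open Enumerators R using (A; P)
  open Hurwitz R
  open import Algebra.Properties.Semiring.Exp semiring using (_^_; ^-congˡ)
  open import Algebra.Properties.Semiring.Mult semiring using (_×_; ×-congʳ)
  open import Algebra.Properties.Semiring.Sum semiring using (sum⁺-syntax; sum-cong-≋)
  open import Algebra.Properties.Group +-group using () renaming (∙-cancelʳ to +-cancelʳ)
  open import Algebra.Solver.Ring.NaturalCoefficients.Default commutativeSemiring
  open import Relation.Binary.Reasoning.Setoid setoid

  -- Here `s` is t², `q` is 1 - t², and `Y`, `Z`, `T` are the arguments of P, each specified by its
  -- product with its denominator.
  module _
    (y t s q Y Z T : Carrier)
    (s≈t² : s ≈ t * t) (q+s≈1 : q + s ≈ 1#)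
    (Y≈ : Y * ((y + s) * (1# + y * t)) ≈ t * (1# + y) * (y + t))
    (Z≈ : Z * ((1# + y * s) * (y + t)) ≈ t * (1# + y) * (1# + y * t))
    (T≈ : T * (1# + y * s) ≈ y + s)
    where

    u v k : Carrier
    u = 1# + y * s
    v = y + s
    k = (y + t) * (1# + y * t)

    -- The end weight is chosen so that d₀ = 1 + y t and u₀ = y + t give it in both states, which is
    -- the content of `e≈`.
    open PeakValleyDescent R Y Z T u ((y + t) * ((1# + y * t) * (1# + t)))

    private
      step-tt : step true true ≈ v
      step-tt = trans (solve 2 (λ u T →
        u :* (con 1 :* con 1 :* (T :* con 1)) := T :* u) refl u T) T≈

      step-ft : step false true ≈ Y * v
      step-ft = trans (solve 3 (λ u Y T →
        u :* (Y :* con 1 :* con 1 :* (T :* con 1)) := Y :* (T :* u)) refl u Y T) (*-congˡ T≈)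

      step-tf : step true false ≈ u * Z
      step-tf = solve 2 (λ u Z → u :* (con 1 :* (Z :* con 1) :* con 1) := u :* Z) refl u Z

      step-ff : step false false ≈ u
      step-ff = solve 1 (λ u → u :* (con 1 :* con 1 :* con 1) := u) refl u

      Yv : (1# + y * t) * (Y * v) ≈ t * (1# + y) * (y + t)
      Yv = trans (solve 3 (λ a Y v → a :* (Y :* v) := Y :* (v :* a)) refl (1# + y * t) Y v) Y≈

      uZ : (y + t) * (u * Z) ≈ t * (1# + y) * (1# + y * t)
      uZ = trans (solve 3 (λ a u Z → a :* (u :* Z) := Z :* (u :* a)) refl (y + t) u Z) Z≈

      1≈ : 1# ≈ q + t * t
      1≈ = trans (sym q+s≈1) (+-congˡ s≈t²)

      u≈ : u ≈ 1# + y * (t * t)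
      u≈ = +-congˡ (*-congˡ s≈t²)

      v≈ : v ≈ y + t * t
      v≈ = +-congˡ s≈t²

      e≈ : ∀ b → (y + t) * ((1# + y * t) * (1# + t)) ≈
                 step b true * (1# + y * t) + step b false * (y + t)
      e≈ true = sym (begin
        step true true * (1# + y * t) + step true false * (y + t)
          ≈⟨ +-cong (*-congʳ (trans step-tt v≈)) (trans (*-congʳ step-tf) (trans (*-comm _ _) uZ)) ⟩
        (y + t * t) * (1# + y * t) + t * (1# + y) * (1# + y * t)
          ≈⟨ solve 2 (λ y t →
               (y :+ t :* t) :* (con 1 :+ y :* t) :+ t :* (con 1 :+ y) :* (con 1 :+ y :* t) :=
               (y :+ t) :* ((con 1 :+ y :* t) :* (con 1 :+ t))) refl y t ⟩
        (y + t) * ((1# + y * t) * (1# + t)) ∎)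
      e≈ false = sym (begin
        step false true * (1# + y * t) + step false false * (y + t)
          ≈⟨ +-cong (trans (*-congʳ step-ft) (trans (*-comm _ _) Yv)) (*-congʳ (trans step-ff u≈)) ⟩
        t * (1# + y) * (y + t) + (1# + y * (t * t)) * (y + t)
          ≈⟨ solve 2 (λ y t →
               t :* (con 1 :+ y) :* (y :+ t) :+ (con 1 :+ y :* (t :* t)) :* (y :+ t) :=
               (y :+ t) :* ((con 1 :+ y :* t) :* (con 1 :+ t))) refl y t ⟩
        (y + t) * ((1# + y * t) * (1# + t)) ∎)

    open Solution (1# + y * t) (y + t) e≈

    private
      -- Eigenvectors for y q and - q. The matrix of step weights with its second row negated has
      -- trace (y - 1) q and determinant - y q².
      α₁ β₁ α₂ β₂ : Carrier
      α₁ = y + t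
      β₁ = t * (1# + y * t)
      α₂ = t * (y + t)
      β₂ = 1# + y * t

      eigen₁-d : α₁ * step true true ≈ β₁ * step false true + y * q * α₁
      eigen₁-d = begin
        α₁ * step true true
          ≈⟨ *-congˡ (trans step-tt v≈) ⟩
        (y + t) * (y + t * t)
          -- Replacing 1 by q + t² leaves an identity without subtraction, which the semiring solver
          -- can prove; the other eigenvector equations use the same device.
          ≈⟨ *-congˡ (+-congʳ (trans (sym (*-identityʳ y)) (*-congˡ 1≈))) ⟩
        (y + t) * (y * (q + t * t) + t * t)
          ≈⟨ solve 3 (λ y t q →
               (y :+ t) :* (y :* (q :+ t :* t) :+ t :* t) :=
               t :* (t :* (con 1 :+ y) :* (y :+ t)) :+ y :* q :* (y :+ t)) refl y t q ⟩
        t * (t * (1# + y) * (y + t)) + y * q * α₁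
          ≈⟨ +-congʳ (*-congˡ Yv) ⟨
        t * ((1# + y * t) * (Y * v)) + y * q * α₁
          ≈⟨ +-congʳ (*-assoc _ _ _) ⟨
        β₁ * (Y * v) + y * q * α₁
          ≈⟨ +-congʳ (*-congˡ step-ft) ⟨
        β₁ * step false true + y * q * α₁ ∎

      eigen₁-u : α₁ * step true false ≈ β₁ * step false false + y * q * β₁
      eigen₁-u = begin
        α₁ * step true false
          ≈⟨ *-congˡ step-tf ⟩
        α₁ * (u * Z)
          ≈⟨ uZ ⟩
        t * (1# + y) * (1# + y * t)
          ≈⟨ solve 2 (λ y t → t :* (con 1 :+ y) :* (con 1 :+ y :* t) :=
               t :* (con 1 :+ y :* t) :* (con 1 :+ y :* con 1)) refl y t ⟩
        β₁ * (1# + y * 1#)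
          ≈⟨ *-congˡ (+-congˡ (*-congˡ 1≈)) ⟩
        β₁ * (1# + y * (q + t * t))
          ≈⟨ solve 4 (λ y t q β → β :* (con 1 :+ y :* (q :+ t :* t)) :=
               β :* (con 1 :+ y :* (t :* t)) :+ y :* q :* β) refl y t q β₁ ⟩
        β₁ * (1# + y * (t * t)) + y * q * β₁
          ≈⟨ +-congʳ (*-congˡ (trans step-ff u≈)) ⟨
        β₁ * step false false + y * q * β₁ ∎

      eigen₂-d : β₂ * step false true ≈ α₂ * step true true + q * α₂
      eigen₂-d = begin
        β₂ * step false true
          ≈⟨ *-congˡ step-ft ⟩
        β₂ * (Y * v)
          ≈⟨ Yv ⟩
        t * (1# + y) * (y + t)
          ≈⟨ *-congʳ (*-congˡ (+-congʳ 1≈)) ⟩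
        t * (q + t * t + y) * (y + t)
          ≈⟨ solve 3 (λ y t q → t :* (q :+ t :* t :+ y) :* (y :+ t) :=
               t :* (y :+ t) :* (y :+ t :* t) :+ q :* (t :* (y :+ t))) refl y t q ⟩
        α₂ * (y + t * t) + q * α₂
          ≈⟨ +-congʳ (*-congˡ (trans step-tt v≈)) ⟨
        α₂ * step true true + q * α₂ ∎

      eigen₂-u : β₂ * step false false ≈ α₂ * step true false + q * β₂
      eigen₂-u = begin
        β₂ * step false false
          ≈⟨ *-congˡ (trans step-ff u≈) ⟩
        (1# + y * t) * (1# + y * (t * t))
          ≈⟨ *-congˡ (+-congʳ 1≈) ⟩
        (1# + y * t) * (q + t * t + y * (t * t))
          ≈⟨ solve 3 (λ y t q → (con 1 :+ y :* t) :* (q :+ t :* t :+ y :* (t :* t)) :=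
               t :* (t :* (con 1 :+ y) :* (con 1 :+ y :* t)) :+ q :* (con 1 :+ y :* t)) refl y t q ⟩
        t * (t * (1# + y) * (1# + y * t)) + q * β₂
          ≈⟨ +-congʳ (*-congˡ uZ) ⟨
        t * ((y + t) * (u * Z)) + q * β₂
          ≈⟨ +-congʳ (*-assoc _ _ _) ⟨
        α₂ * (u * Z) + q * β₂
          ≈⟨ +-congʳ (*-congˡ step-tf) ⟨
        α₂ * step true false + q * β₂ ∎

    -- The right-hand side of the identity for n + 1.
    Q : ℕ → Carrier
    Q n = (1# + y * t) * (1# + t) * u ^ n * P (suc n) Y Z T

    -- The value at 0 is the one that fits the functional equation.
    G : Series
    G zero    = 1# + t
    G (suc n) = t * Q n

    private
      U≈Q : ∀ n → U (suc n) 0 (suc n) ≈ (y + t) * Q n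
      U≈Q n = trans (above≈P n) (solve 5 (λ a b c d e →
        a :* (b :* c) :* d :* e := a :* (b :* c :* d :* e)) refl _ _ _ _ _)

      combination-0 : ∀ α β n → combination α β (suc n) 0 (suc n) ≈ β * ((y + t) * Q n)
      combination-0 α β n = trans (+-cong (zeroʳ α) (*-congˡ (U≈Q n))) (+-identityˡ _)

      -- For positive n the part `D` vanishes at a = 0, and the `U` that remains is a multiple of
      -- `Q`.
      initial₁ : ∀ n → combination α₁ β₁ n 0 n ≈ k * G n
      initial₁ zero    = solve 2 (λ y t →
        (y :+ t) :* (con 1 :+ y :* t) :+ t :* (con 1 :+ y :* t) :* (y :+ t) :=
        (y :+ t) :* (con 1 :+ y :* t) :* (con 1 :+ t)) refl y t
      initial₁ (suc n) = trans (combination-0 α₁ β₁ n) (solve 4 (λ a b t Q →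
        t :* b :* (a :* Q) := a :* b :* (t :* Q)) refl (y + t) (1# + y * t) t (Q n))

      -- Since β₁ = t β₂, the factor t turns the second combination into the first at a = 0; for n =
      -- 0 they differ by q k, because 1 = q + t².
      initial₂ : ∀ n → k * G n ≈ t * combination α₂ β₂ n 0 n + q * const k n
      initial₂ zero    = begin
        k * (1# + t)
          ≈⟨ *-congˡ (+-congʳ 1≈) ⟩
        k * (q + t * t + t)
          ≈⟨ solve 4 (λ a b t q → a :* b :* (q :+ t :* t :+ t) :=
               t :* (t :* a :* b :+ b :* a) :+ q :* (a :* b)) refl (y + t) (1# + y * t) t q ⟩
        t * combination α₂ β₂ 0 0 0 + q * k ∎
      initial₂ (suc n) = begin
        k * (t * Q n)
          ≈⟨ solve 5 (λ a b t Q q → a :* b :* (t :* Q) :=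
               t :* (b :* (a :* Q)) :+ q :* con 0) refl (y + t) (1# + y * t) t (Q n) q ⟩
        t * (β₂ * ((y + t) * Q n)) + q * 0#
          ≈⟨ +-congʳ (*-congˡ (combination-0 α₂ β₂ n)) ⟨
        t * combination α₂ β₂ (suc n) 0 (suc n) + q * 0# ∎

      -- For positive n the part `U` vanishes at b = 0, and α₂ = t α₁; for n = 0 the two sides again
      -- differ by q k before the correction.
      boundary : ∀ n → combination α₂ β₂ n n 0 ≈ t * combination α₁ β₁ n n 0 + q * const k n
      boundary zero    = begin
        t * (y + t) * (1# + y * t) + (1# + y * t) * (y + t)
          ≈⟨ solve 3 (λ a b t → t :* a :* b :+ b :* a := a :* b :* (con 1 :+ t))
               refl (y + t) (1# + y * t) t ⟩
        k * (1# + t)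
          ≈⟨ *-congˡ (+-congʳ 1≈) ⟩
        k * (q + t * t + t)
          ≈⟨ solve 4 (λ a b t q → a :* b :* (q :+ t :* t :+ t) :=
               t :* (a :* b :+ t :* b :* a) :+ q :* (a :* b)) refl (y + t) (1# + y * t) t q ⟩
        t * combination α₁ β₁ 0 0 0 + q * k ∎
      boundary (suc n) = solve 5 (λ a b t q d →
        t :* a :* d :+ b :* con 0 := t :* (a :* d :+ t :* b :* con 0) :+ q :* con 0)
        refl (y + t) (1# + y * t) t q (D (suc n) (suc n) 0)

    module _ (cancel-k : Cancellable k) (cancel-q : Cancellable q) where

      module Series = CommutativeSemiring commutativeSemiring′
      open import Algebra.Solver.Ring.NaturalCoefficients.Default commutativeSemiring′
        using () renaming
        (solve to solve′; _:+_ to _⟨+⟩_; _:*_ to _⟨*⟩_; _:=_ to _⟨=⟩_; con to con′)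
      import Relation.Binary.Reasoning.Setoid Series.setoid as ≋

      const-⊛-cancel : ∀ {a f g} → Cancellable a → const a ⊛ f ≋ const a ⊛ g → f ≋ g
      const-⊛-cancel {a} {f} {g} cancel p .at n =
        cancel (trans (sym (const-⊛ a f n)) (trans (p .at n) (const-⊛ a g n)))

      growth : Series
      growth = exp ((1# + y) * q)

      growth≋ : exp q ⊛ exp (y * q) ≋ growth
      growth≋ = Series.trans (exp-⊛ q (y * q)) (coeffs λ n → ^-congˡ n
        (solve 2 (λ y q → q :+ y :* q := (con 1 :+ y) :* q) refl y q))

      -- A round trip: from a = 0 to b = 0 by the eigenvector for - q, across to the other
      -- eigenvector by `boundary`, and back to a = 0 by the eigenvector for y q. The two
      -- exponentials multiply to `growth`, and the common factor k cancels.
      G-equation : G ≋ const q ⊛ (const 1# ⊕ const t ⊛ exp q) ⊕ const s ⊛ (growth ⊛ G)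
      G-equation = const-⊛-cancel cancel-k (≋.begin
        const k ⊛ G
          ≋.≈⟨ (coeffs λ n → trans (const-⊛ k G n) (trans (initial₂ n)
                 (sym (+-cong (const-⊛ t h₃ n) (const-⊛ q (const k) n))))) ⟩
        const t ⊛ h₃ ⊕ const q ⊛ const k
          ≋.≈⟨ Series.+-congʳ (Series.*-congˡ
                 (coeffs (backward α₂ β₂ q eigen₂-d eigen₂-u))) ⟩
        const t ⊛ (exp q ⊛ h₂) ⊕ const q ⊛ const k
          ≋.≈⟨ Series.+-congʳ (Series.*-congˡ (Series.*-congˡ (coeffs λ n →
                 trans (boundary n)
                 (sym (+-cong (const-⊛ t h₁ n) (const-⊛ q (const k) n)))))) ⟩
        const t ⊛ (exp q ⊛ (const t ⊛ h₁ ⊕ const q ⊛ const k)) ⊕ const q ⊛ const k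
          ≋.≈⟨ Series.+-congʳ (Series.*-congˡ (Series.*-congˡ (Series.+-congʳ
                 (Series.*-congˡ (coeffs λ n →
                   trans (forward α₁ β₁ (y * q) eigen₁-d eigen₁-u n)
                   (⊛-cong (λ _ → refl) (λ m → trans (initial₁ m) (sym (const-⊛ k G m))) n)))))) ⟩
        const t ⊛ (exp q ⊛ (const t ⊛ (exp (y * q) ⊛ (const k ⊛ G)) ⊕ const q ⊛ const k)) ⊕
        const q ⊛ const k
          ≋.≈⟨ solve′ 6 (λ t e e′ k G q →
                 t ⟨*⟩ (e ⟨*⟩ (t ⟨*⟩ (e′ ⟨*⟩ (k ⟨*⟩ G)) ⟨+⟩ q ⟨*⟩ k)) ⟨+⟩ q ⟨*⟩ k ⟨=⟩
                 k ⟨*⟩ (q ⟨*⟩ (con′ 1 ⟨+⟩ t ⟨*⟩ e) ⟨+⟩ (t ⟨*⟩ t) ⟨*⟩ ((e ⟨*⟩ e′) ⟨*⟩ G)))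
                 Series.refl (const t) (exp q) (exp (y * q)) (const k) G (const q) ⟩
        const k ⊛ (const q ⊛ (const 1# ⊕ const t ⊛ exp q) ⊕
          (const t ⊛ const t) ⊛ ((exp q ⊛ exp (y * q)) ⊛ G))
          ≋.≈⟨ Series.*-congˡ (Series.+-congˡ (Series.*-cong
                 (Series.sym (Series.trans const-s≋ (const-*-homo t t)))
                 (Series.*-congʳ growth≋))) ⟩
        const k ⊛ (const q ⊛ (const 1# ⊕ const t ⊛ exp q) ⊕ const s ⊛ (growth ⊛ G)) ≋.∎)
        where
        h₁ h₂ h₃ : Series
        h₁ n = combination α₁ β₁ n n 0
        h₂ n = combination α₂ β₂ n n 0
        h₃ n = combination α₂ β₂ n 0 n

        const-s≋ : const s ≋ const (t * t)
        const-s≋ .at zero    = s≈t²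
        const-s≋ .at (suc n) = refl

      𝒜 : Series
      𝒜 = scale (1# + y) (λ n → A n s)

      -- The Eulerian equation at t² with (1 + y) x in place of x, which turns e^(q x) into
      -- `growth`.
      𝒜-equation : 𝒜 ≋ const q ⊕ const s ⊛ (growth ⊛ 𝒜)
      𝒜-equation = ≋.begin
        𝒜
          ≋.≈⟨ (coeffs λ n → *-congˡ (trans (Eulerian.A-equation R s q q+s≈1 n)
                 (+-congˡ (sym (const-⊛ s _ n))))) ⟩
        scale (1# + y) (const q ⊕ const s ⊛ (exp q ⊛ (λ n → A n s)))
          ≋.≈⟨ (coeffs λ n → distribˡ _ _ _) ⟩
        scale (1# + y) (const q) ⊕ scale (1# + y) (const s ⊛ (exp q ⊛ (λ n → A n s)))
          ≋.≈⟨ Series.+-cong (scale-const (1# + y) q)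
                 (Series.trans (scale-⊛ (1# + y) (const s) _)
                   (Series.*-cong (scale-const (1# + y) s)
                     (Series.trans (scale-⊛ (1# + y) (exp q) _)
                       (Series.*-congʳ (scale-exp (1# + y) q))))) ⟩
        const q ⊕ const s ⊛ (growth ⊛ 𝒜) ≋.∎

      -- Expand 𝒜 ⊛ G with either functional equation; no division by the common
      -- factor 1 - s·growth is needed.
      G≋ : G ≋ 𝒜 ⊕ const t ⊛ (𝒜 ⊛ exp q)
      G≋ = const-⊛-cancel cancel-q (coeffs λ n → +-cancelʳ _ _ _ (expansions .at n))
        where
        expansions : const q ⊛ G ⊕ const s ⊛ (growth ⊛ (𝒜 ⊛ G)) ≋
          const q ⊛ (𝒜 ⊕ const t ⊛ (𝒜 ⊛ exp q)) ⊕ const s ⊛ (growth ⊛ (𝒜 ⊛ G))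
        expansions = ≋.begin
          const q ⊛ G ⊕ const s ⊛ (growth ⊛ (𝒜 ⊛ G))
            ≋.≈⟨ solve′ 5 (λ q s E A G →
                   q ⟨*⟩ G ⟨+⟩ s ⟨*⟩ (E ⟨*⟩ (A ⟨*⟩ G)) ⟨=⟩
                   (q ⟨+⟩ s ⟨*⟩ (E ⟨*⟩ A)) ⟨*⟩ G)
                   Series.refl (const q) (const s) growth 𝒜 G ⟩
          (const q ⊕ const s ⊛ (growth ⊛ 𝒜)) ⊛ G
            ≋.≈⟨ Series.*-congʳ 𝒜-equation ⟨
          𝒜 ⊛ G
            ≋.≈⟨ Series.*-congˡ G-equation ⟩
          𝒜 ⊛ (const q ⊛ (const 1# ⊕ const t ⊛ exp q) ⊕ const s ⊛ (growth ⊛ G))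
            ≋.≈⟨ solve′ 7 (λ q s E A G t e →
                   A ⟨*⟩ (q ⟨*⟩ (con′ 1 ⟨+⟩ t ⟨*⟩ e) ⟨+⟩ s ⟨*⟩ (E ⟨*⟩ G)) ⟨=⟩
                   q ⟨*⟩ (A ⟨+⟩ t ⟨*⟩ (A ⟨*⟩ e)) ⟨+⟩ s ⟨*⟩ (E ⟨*⟩ (A ⟨*⟩ G)))
                   Series.refl (const q) (const s) growth 𝒜 G (const t) (exp q) ⟩
          const q ⊛ (𝒜 ⊕ const t ⊛ (𝒜 ⊛ exp q)) ⊕ const s ⊛ (growth ⊛ (𝒜 ⊛ G)) ≋.∎

      -- Here `r` plays the role of (1 + y)^(n+1) / t. Multiplied by t, the two sides are the
      -- coefficients at n + 1 of the two series in `G≋`.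
      identity : Cancellable t → ∀ n r → r * t ≈ (1# + y) ^ suc n →
        r * A (suc n) s +
        ∑[ i ≤ suc n ] ((suc n C toℕ i) ×
          ((1# + y) ^ toℕ i * q ^ (suc n ∸ toℕ i) * A (toℕ i) s))
        ≈ (1# + y * t) * (1# + t) * u ^ n * P (suc n) Y Z T
      identity cancel-t n r r≈ = cancel-t (begin
        t * (r * A (suc n) s + ∑[ i ≤ suc n ] ((suc n C toℕ i) ×
          ((1# + y) ^ toℕ i * q ^ (suc n ∸ toℕ i) * A (toℕ i) s)))
          ≈⟨ *-congˡ (+-congˡ (sum-cong-≋ {suc (suc n)} λ i → ×-congʳ (suc n C toℕ i)
               (solve 3 (λ a b c → a :* b :* c := a :* c :* b) refl
                 ((1# + y) ^ toℕ i) (q ^ (suc n ∸ toℕ i)) (A (toℕ i) s)))) ⟩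
        t * (r * A (suc n) s + ∑[ i ≤ suc n ] ((suc n C toℕ i) ×
          (𝒜 (toℕ i) * exp q (suc n ∸ toℕ i))))
          ≈⟨ *-congˡ (+-congˡ (⊛-binomial 𝒜 (exp q) (suc n))) ⟨
        t * (r * A (suc n) s + (𝒜 ⊛ exp q) (suc n))
          ≈⟨ solve 4 (λ t r a z → t :* (r :* a :+ z) := (r :* t) :* a :+ t :* z) refl _ _ _ _ ⟩
        r * t * A (suc n) s + t * (𝒜 ⊛ exp q) (suc n)
          ≈⟨ +-cong (*-congʳ r≈) (sym (const-⊛ t (𝒜 ⊛ exp q) (suc n))) ⟩
        (𝒜 ⊕ const t ⊛ (𝒜 ⊛ exp q)) (suc n)
          ≈⟨ G≋ .at (suc n) ⟨
        G (suc n) ∎)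

-- Specialisation to rational functions in y and t.

open import Defs
open import Data.Fin.Base using (toℕ)
open import Data.Nat.Base using (ℕ; _∸_; _≥_)
open import Data.Nat.Combinatorics using (_C_)

theorem4p15 : (n : ℕ) → n ≥ 1 →
    (((1# + y) ^ n) / t) * A n (t ^ 2)
    + ∑[ k ≤ n ] ((n C toℕ k) × ((1# + y) ^ toℕ k * (1# - t ^ 2) ^ (n ∸ toℕ k) * A (toℕ k) (t ^ 2)))
    ≈ (1# + y * t) * (1# + t) * (1# + y * t ^ 2) ^ (n ∸ 1)
    * P n ((t * (1# + y) * (y + t)) / ((y + t ^ 2) * (1# + y * t)))
    ((t * (1# + y) * (1# + y * t)) / ((1# + y * t ^ 2) * (y + t)))
    ((y + t ^ 2) / (1# + y * t ^ 2))
theorem4p15 (suc n) _ = identity y t (t ^ 2) (1# - t ^ 2)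
  ((t * (1# + y) * (y + t)) / ((y + t ^ 2) * (1# + y * t)))
  ((t * (1# + y) * (1# + y * t)) / ((1# + y * t ^ 2) * (y + t)))
  ((y + t ^ 2) / (1# + y * t ^ 2))
  -- The power t ^ 2 unfolds to t * (t * 1#).
  (*-congˡ {t} {t * 1#} {t} (*-identityʳ t))
  (//-rightDividesˡ (t ^ 2) 1#)
  (/-cancel (t * (1# + y) * (y + t)) ((y + t ^ 2) * (1# + y * t)))
  (/-cancel (t * (1# + y) * (1# + y * t)) ((1# + y * t ^ 2) * (y + t)))
  (/-cancel (y + t ^ 2) (1# + y * t ^ 2))
  (nonzero ((y + t) * (1# + y * t))) (nonzero (1# - t ^ 2)) (nonzero t)
  n (((1# + y) ^ suc n) / t) (/-cancel ((1# + y) ^ suc n) t)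
  where
  open CommutativeRing ℚ⟨y,t⟩.commutativeRing
    using (0#; *-congˡ; *-identityʳ; +-group)
  open import Algebra.Properties.Group +-group using (//-rightDividesˡ)
  open Cancellation ℚ⟨y,t⟩.commutativeRing
  open Identity ℚ⟨y,t⟩.commutativeRing
  open ℚ⟨y,t⟩ using (_≃?_; /-cancel)

  -- For a closed fraction the implicit condition is settled by evaluating the decision procedure; 1
  -- / a is then an inverse.
  nonzero : ∀ a {a≄0 : False (a ≃? 0#)} → Cancellable a
  nonzero a {a≄0} = leftInverse⇒cancellable {a} {(1# / a) {a≄0}} (/-cancel 1# a {a≄0})
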